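{- For all graphs $G$ and $H$, $$\operatorname{tw}(G\,\square\, H)\geq \tfrac{1}{2}(\operatorname{tw}(G)+1)(\operatorname{tw}(H)+1)-1.$$
   Context: All graphs are simple, finite and undirected. A tree-decomposition of a graph $G$ is a pair $(T,\beta)$ consisting of a tree $T$ and a function $\beta:V(T)\to 2^{V(G)}$ such that (i) for every $v\in V(G)$, the set $\{t\in V(T): v\in\beta(t)\}$ is non-empty and induces a connected subgraph of $T$; and (ii) for every edge $uv\in E(G)$ there is $t\in V(T)$ with $\{u,v\}\subseteq\beta(t)$. Its width is $\max_{t\in V(T)}|\beta(t)|-1$. The treewidth $\operatorname{tw}(G)$ is the minimum width of a tree-decomposition of $G$. The Cartesian product $G\,\square\, H$ is the graph with vertex set $V(G)\times V(H)$, where $(g_1,h_1)(g_2,h_2)$ is an edge if and only if $g_1=g_2$ and $h_1h_2\in E(H)$; or $g_1g_2\in E(G)$ and $h_1=h_2$. -}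

module Defs where

open import Data.Empty using (⊥; ⊥-elim)
open import Data.Fin using (Fin; zero; suc; fromℕ; inject₁; combine; remQuot)
import Data.Fin.Properties as Fin
open import Data.Fin.Subset using (Subset; _∈_; ∣_∣; ⊤)
open import Data.Fin.Subset.Properties using (∈⊤)
open import Data.Integer using (ℤ; +_; 1ℤ) renaming (_-_ to _-ℤ_; _≤_ to _≤ℤ_; -_ to -ℤ_; +≤+ to +≤+ℤ)
import Data.Integer.Properties as ℤ
open import Data.List using (map; allFin)
open import Data.List.Extrema.Nat using (max)
open import Data.Nat using (ℕ; NonZero; _<_; _≤?_; _+_; _*_)
open import Data.Nat.Induction using (<-rec)
open import Data.Nat.Properties using (≰⇒>)
open import Data.Product using (Σ-syntax; ∃; ∃-syntax; _×_; _,_)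
open import Data.Sum using (_⊎_; inj₁; inj₂)
open import Function using (_∘_)
open import Function.Definitions using (Injective)
open import Level using (0ℓ)
open import Relation.Binary using (Rel; Decidable; Symmetric; Irreflexive)
open import Relation.Binary.Construct.Closure.ReflexiveTransitive using (Star; ε)
open import Relation.Binary.PropositionalEquality using (_≡_; refl; sym)
open import Relation.Nullary using (¬_; yes; no)
open import Relation.Nullary.Decidable using (_×-dec_; _⊎-dec_)
open import Relation.Unary using (Pred; U; Satisfiable)

record Graph : Set₁ where
  field
    order  : ℕ
    Adj    : Rel (Fin order) 0ℓ
    adj?   : Decidable Adj
    symm   : Symmetric Adj
    irrefl : Irreflexive _≡_ Adj

  Vertex : Set
  Vertex = Fin order

open Graph public using (Vertex)

-- The vertex (g , h) is encoded as combine g h; remQuot is the inverse.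
infixl 7 _□_
_□_ : Graph → Graph → Graph
G □ H = record
  { order  = G.order * H.order
  ; Adj    = λ x y → Edge (split x) (split y)
  ; adj?   = λ x y → edge? (split x) (split y)
  ; symm   = λ {x} {y} → edge-sym (split x) (split y)
  ; irrefl = λ { {x} refl → edge-irrefl (split x) }
  }
  where
  module G = Graph G
  module H = Graph H

  split : Fin (G.order * H.order) → Vertex G × Vertex H
  split = remQuot H.order

  Edge : Rel (Vertex G × Vertex H) 0ℓ
  Edge (g₁ , h₁) (g₂ , h₂) = (g₁ ≡ g₂ × H.Adj h₁ h₂) ⊎ (G.Adj g₁ g₂ × h₁ ≡ h₂)

  edge? : Decidable Edge
  edge? (g₁ , h₁) (g₂ , h₂) =
    ((g₁ Fin.≟ g₂) ×-dec H.adj? h₁ h₂) ⊎-dec (G.adj? g₁ g₂ ×-dec (h₁ Fin.≟ h₂))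

  edge-sym : ∀ p q → Edge p q → Edge q p
  edge-sym _ _ (inj₁ (g≡ , h~)) = inj₁ (sym g≡ , H.symm h~)
  edge-sym _ _ (inj₂ (g~ , h≡)) = inj₂ (G.symm g~ , sym h≡)

  edge-irrefl : ∀ p → ¬ Edge p p
  edge-irrefl _ (inj₁ (_ , h~)) = H.irrefl refl h~
  edge-irrefl _ (inj₂ (g~ , _)) = G.irrefl refl g~

-- Any two vertices of the subgraph induced by P are joined by a walk in it.
-- Holds for empty P.
InducesConnected : (G : Graph) → Pred (Vertex G) 0ℓ → Set
InducesConnected G P =
  ∀ {x y} → P x → P y → Star (λ a b → P a × P b × Graph.Adj G a b) x y

-- A cycle has at least three vertices: c 0 , … , c (2 + k).
record Cycle (G : Graph) : Set where
  open Graph G using (Adj)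
  field
    k        : ℕ
    c        : Fin (3 + k) → Vertex G
    distinct : Injective _≡_ _≡_ c
    step     : ∀ i → Adj (c (inject₁ i)) (c (suc i))
    close    : Adj (c (fromℕ (2 + k))) (c zero)

record IsTree (T : Graph) : Set where
  field
    nonEmpty  : NonZero (Graph.order T)
    connected : InducesConnected T U
    acyclic   : ¬ Cycle T

record TreeDecomposition (G : Graph) : Set₁ where
  field
    T      : Graph
    isTree : IsTree T
    β      : Vertex T → Subset (Graph.order G)

  BagsContaining : Vertex G → Pred (Vertex T) 0ℓ
  BagsContaining v t = v ∈ β t

  field
    vertexCovered   : ∀ v → Satisfiable (BagsContaining v)
    vertexConnected : ∀ v → InducesConnected T (BagsContaining v)
    edgeCovered     : ∀ {u v} → Graph.Adj G u v → ∃[ t ] (u ∈ β t × v ∈ β t)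

  -- T has a node, so the default value 0 does not affect the maximum.
  maxBagSize : ℕ
  maxBagSize = max 0 (map (∣_∣ ∘ β) (allFin (Graph.order T)))

  -- An integer: the graph without vertices has a decomposition of width -1.
  width : ℤ
  width = + maxBagSize -ℤ 1ℤ

open TreeDecomposition public using (width; maxBagSize)

-- Treewidth G k says that tw(G) = k.
Treewidth : Graph → ℤ → Set₁
Treewidth G k =
  (Σ[ D ∈ TreeDecomposition G ] width D ≡ k) ×
  ((D : TreeDecomposition G) → k ≤ℤ width D)

-- Treewidth G is single-valued, and (up to double negation) has a value.
treewidth-unique : ∀ G {k l} → Treewidth G k → Treewidth G l → k ≡ l
treewidth-unique G ((D , refl) , k≤) ((E , refl) , l≤) = ℤ.≤-antisym (k≤ E) (l≤ D)

oneBag : ∀ G → TreeDecomposition G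
oneBag G = record
  { T = record
      { order = 1 ; Adj = λ _ _ → ⊥ ; adj? = λ _ _ → no λ ()
      ; symm = λ () ; irrefl = λ _ () }
  ; isTree = record
      { nonEmpty = _
      ; connected = λ { {zero} {zero} _ _ → ε }
      ; acyclic = Cycle.close }
  ; β = λ _ → ⊤
  ; vertexCovered = λ _ → zero , ∈⊤
  ; vertexConnected = λ { _ {zero} {zero} _ _ → ε }
  ; edgeCovered = λ _ → zero , ∈⊤ , ∈⊤
  }

treewidth-exists : ∀ G → ¬ ¬ ∃ (Treewidth G)
treewidth-exists G none = <-rec NoneOfSize step _ (oneBag G) refl
  where
  NoneOfSize : ℕ → Set₁
  NoneOfSize m = (D : TreeDecomposition G) → ¬ (maxBagSize D ≡ m)

  step : ∀ m → (∀ {n} → n < m → NoneOfSize n) → NoneOfSize m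
  step m smaller D refl = none (width D , (D , refl) , minimal)
    where
    minimal : (E : TreeDecomposition G) → width D ≤ℤ width E
    minimal E with maxBagSize D ≤? maxBagSize E
    ... | yes D≤E = ℤ.+-monoˡ-≤ (-ℤ 1ℤ) (+≤+ℤ D≤E)
    ... | no  D≰E = ⊥-elim (smaller (≰⇒> D≰E) E refl)

{-# OPTIONS --safe #-}
module Submission where

-- Treewidth is dual to tangles of edge sets. Call a family of edge sets an ideal if it is closed
-- under subsets and contains every set with few end vertices, and let a set be derivable if it can
-- be split repeatedly, each time along few vertices, into members of the ideal. A derivation of the
-- full edge set from the smallest ideal is a tree-decomposition of small width. Otherwise take a
-- maximal ideal that does not derive the full set: by submodularity of the boundary, any two sets
-- outside it intersect, so it decides for every small S ⊆ V which side of S is large.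
--
-- Given such tangles of orders a and b on G and H and a set S of fewer than ab/2 vertices of G □ H,
-- fewer than a of the fibers {g} × H meet S in at least b/2 vertices. In every other fiber the
-- tangle of H selects a side of S; adjacent fibers select the same side, since together they meet S
-- in fewer than b vertices. The tangle of G then selects one side globally. In a tree-decomposition
-- of G □ H with all bags smaller than ab/2, every branch would be small by induction from the
-- leaves, hence so would be the whole edge set.

open import Defs
open import Data.Integer using (ℤ)
open import Data.Rational using (½; 1ℚ; _/_; _+_; _*_; _-_; _≥_)
open import Data.Rational as ℚ using (ℚ; mkℚ; toℚᵘ)
import Data.Rational.Properties as ℚ
import Data.Rational.Unnormalised as ℚᵘ
import Data.Rational.Unnormalised.Properties as ℚᵘ
open import Data.Integer as ℤ using (+_; 1ℤ; -1ℤ)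
import Data.Integer.Properties as ℤ
open import Data.Nat as ℕ using (ℕ; zero; suc; _≤_; _<_; z≤n; s≤s; _≤?_; _^_; NonZero)
  renaming (_+_ to _+ℕ_; _*_ to _*ℕ_)
import Data.Nat.Properties as ℕ
open import Data.Nat.Coprimality using (1-coprimeTo) renaming (sym to coprime-sym)
open import Data.Nat.Induction using (<-rec)
open import Algebra.Properties.CommutativeSemigroup using (interchange)
open import Data.Bool as Bool using (Bool; true; false; not; _∧_; _∨_; if_then_else_)
open import Data.Bool.Properties using (∨-zeroʳ; not-involutive; ⇔→≡)
open import Data.Empty using (⊥; ⊥-elim)
open import Data.Fin using (Fin; zero; suc; toℕ; fromℕ; inject₁; combine; remQuot;
  finToFun; funToFin; _↑ˡ_; _↑ʳ_)
import Data.Fin.Properties as Fin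
open import Data.Fin.Relation.Unary.Top using (view; ‵fromℕ; ‵inject₁)
open import Data.Fin.Subset using (Subset; ∣_∣; _∈_)
open import Data.List as List using (List; []; _∷_; length; allFin)
open import Data.List.Extrema.Nat using (max≤v⁺; xs≤max)
open import Data.List.Membership.Propositional using () renaming (_∈_ to _∈ᴸ_; _∉_ to _∉ᴸ_)
open import Data.List.Membership.Propositional.Properties using (∈-allFin; ∈-lookup)
import Data.List.Membership.DecPropositional as DecMembership
import Data.List.Relation.Unary.All as All
import Data.List.Relation.Unary.All.Properties as All
open import Data.List.Relation.Unary.Any using (here; there)
open import Data.Product as Product using (∃; Σ-syntax; _×_; _,_; proj₁; proj₂)
open import Data.Sum as Sum using (_⊎_; inj₁; inj₂; [_,_]′)
open import Data.Vec using ([]; _∷_; tabulate; lookup)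
import Data.Vec.Properties as Vec
open import Function using (_∘_; mk⇔)
open import Function.Definitions using (Injective)
open import Relation.Binary.Construct.Closure.ReflexiveTransitive using (Star; ε; _◅_; _◅◅_; gmap)
open import Relation.Binary.PropositionalEquality
  using (_≡_; _≗_; refl; sym; trans; cong; cong₂; subst; subst₂)
open import Relation.Nullary using (¬_; Dec; yes; no; does)
open import Relation.Nullary.Decidable
  using (dec-true; toWitness; map′; ¬?; _→-dec_; _×-dec_; _⊎-dec_; ¬¬-excluded-middle)
open import Relation.Unary using (U)

-- Boolean predicates on finite sets

∧-true⁻ : ∀ {x y} → x ∧ y ≡ true → x ≡ true × y ≡ true
∧-true⁻ {true} {true} _ = refl , refl

∧-true⁺ : ∀ {x y} → x ≡ true → y ≡ true → x ∧ y ≡ true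
∧-true⁺ refl refl = refl

∨-true⁻ : ∀ {x y} → x ∨ y ≡ true → x ≡ true ⊎ y ≡ true
∨-true⁻ {true}  _ = inj₁ refl
∨-true⁻ {false} p = inj₂ p

∨-true⁺ˡ : ∀ {x y} → x ≡ true → x ∨ y ≡ true
∨-true⁺ˡ refl = refl

∨-true⁺ʳ : ∀ {x y} → y ≡ true → x ∨ y ≡ true
∨-true⁺ʳ {x} refl = ∨-zeroʳ x

not-true⁻ : ∀ {x} → not x ≡ true → x ≡ false
not-true⁻ {false} _ = refl

not-true⁺ : ∀ {x} → x ≡ false → not x ≡ true
not-true⁺ refl = refl

true≢false : ∀ {x} → x ≡ true → ¬ x ≡ false
true≢false refl ()

true⊎false : ∀ x → x ≡ true ⊎ x ≡ false
true⊎false true  = inj₁ refl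
true⊎false false = inj₂ refl

¬true⇒false : ∀ {x} → ¬ x ≡ true → x ≡ false
¬true⇒false {true}  n = ⊥-elim (n refl)
¬true⇒false {false} _ = refl

¬false⇒true : ∀ {x} → ¬ x ≡ false → x ≡ true
¬false⇒true {true}  _ = refl
¬false⇒true {false} n = ⊥-elim (n refl)

does⁻ : ∀ {a} {A : Set a} (A? : Dec A) → does A? ≡ true → A
does⁻ (yes a) _ = a

any : ∀ {n} → (Fin n → Bool) → Bool
any {zero}  p = false
any {suc n} p = p zero ∨ any (p ∘ suc)

any⁺ : ∀ {n} (p : Fin n → Bool) i → p i ≡ true → any p ≡ true
any⁺ p zero    pi = ∨-true⁺ˡ pi
any⁺ p (suc i) pi = ∨-true⁺ʳ {p zero} (any⁺ (p ∘ suc) i pi)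

any⁻ : ∀ {n} (p : Fin n → Bool) → any p ≡ true → ∃ λ i → p i ≡ true
any⁻ {suc n} p eq with ∨-true⁻ {p zero} eq
... | inj₁ p0 = zero , p0
... | inj₂ ps with any⁻ (p ∘ suc) ps
...   | i , pi = suc i , pi

bit : Bool → ℕ
bit b = if b then 1 else 0

bit-mono : ∀ {b c} → (b ≡ true → c ≡ true) → bit b ≤ bit c
bit-mono {true}  h rewrite h refl = s≤s z≤n
bit-mono {false} h = z≤n

count : ∀ {n} → (Fin n → Bool) → ℕ
count {zero}  p = 0
count {suc n} p = bit (p zero) +ℕ count (p ∘ suc)

infix 4 _⊑_
_⊑_ : ∀ {n} → (Fin n → Bool) → (Fin n → Bool) → Set
X ⊑ Y = ∀ i → X i ≡ true → Y i ≡ true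

⊑-antisym : ∀ {n} {X Y : Fin n → Bool} → X ⊑ Y → Y ⊑ X → X ≗ Y
⊑-antisym f g i = ⇔→≡ (mk⇔ (f i) (g i))

≗⇒⊑ : ∀ {n} {X Y : Fin n → Bool} → X ≗ Y → X ⊑ Y
≗⇒⊑ eq i Xi = trans (sym (eq i)) Xi

count-mono : ∀ {n} {p q : Fin n → Bool} → p ⊑ q → count p ≤ count q
count-mono {zero}  h = z≤n
count-mono {suc n} h = ℕ.+-mono-≤ (bit-mono (h zero)) (count-mono (h ∘ suc))

count-mono-< : ∀ {n} {p q : Fin n → Bool} → p ⊑ q →
               ∀ i → p i ≡ false → q i ≡ true → count p < count q
count-mono-< {p = p} {q} h zero    pi qi rewrite pi | qi = s≤s (count-mono (h ∘ suc))
count-mono-< {p = p} {q} h (suc i) pi qi =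
  ℕ.+-mono-≤-< (bit-mono (h zero)) (count-mono-< (h ∘ suc) i pi qi)

count-mono₂ : ∀ {n} {p q r s : Fin n → Bool} →
              (∀ v → bit (p v) +ℕ bit (q v) ≤ bit (r v) +ℕ bit (s v)) →
              count p +ℕ count q ≤ count r +ℕ count s
count-mono₂ {zero} h = z≤n
count-mono₂ {suc n} {p} {q} {r} {s} h =
  subst₂ _≤_
    (interchange ℕ.+-commutativeSemigroup (bit (p zero)) (bit (q zero)) (count (p ∘ suc)) (count (q ∘ suc)))
    (interchange ℕ.+-commutativeSemigroup (bit (r zero)) (bit (s zero)) (count (r ∘ suc)) (count (s ∘ suc)))
    (ℕ.+-mono-≤ (h zero) (count-mono₂ (h ∘ suc)))

count-∪ : ∀ {n} (p q : Fin n → Bool) → count (λ v → p v ∨ q v) ≤ count p +ℕ count q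
count-∪ {zero} p q = z≤n
count-∪ {suc n} p q =
  subst (count (λ v → p v ∨ q v) ≤_)
    (interchange ℕ.+-commutativeSemigroup (bit (p zero)) (bit (q zero)) (count (p ∘ suc)) (count (q ∘ suc)))
    (ℕ.+-mono-≤ (bit-∨ (p zero) (q zero)) (count-∪ (p ∘ suc) (q ∘ suc)))
  where
  bit-∨ : ∀ b c → bit (b ∨ c) ≤ bit b +ℕ bit c
  bit-∨ true  c = s≤s z≤n
  bit-∨ false c = ℕ.≤-refl

count-none : ∀ {n} {p : Fin n → Bool} → (∀ i → p i ≡ false) → count p ≡ 0
count-none {zero}  h = refl
count-none {suc n} h = cong₂ _+ℕ_ (cong bit (h zero)) (count-none (h ∘ suc))

infixr 6 _∪_
infixr 7 _∩_ _∖_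

∅ full : ∀ {n} → Fin n → Bool
∅ _ = false
full _ = true

∁ : ∀ {n} → (Fin n → Bool) → Fin n → Bool
∁ X i = not (X i)

_∪_ _∩_ _∖_ : ∀ {n} → (Fin n → Bool) → (Fin n → Bool) → Fin n → Bool
(X ∪ Y) i = X i ∨ Y i
(X ∩ Y) i = X i ∧ Y i
(X ∖ Y) i = X i ∧ not (Y i)

-- Running through both values decides Boolean laws; the truth tables below are then proved by
-- evaluation.
allᵇ? : ∀ {P : Bool → Set} → (∀ b → Dec (P b)) → Dec (∀ b → P b)
allᵇ? P? = map′ (λ { (t , f) → λ { true → t ; false → f } }) (λ h → h true , h false)
                (P? true ×-dec P? false)

exactlyOne : Bool → Bool → Bool → Bool
exactlyOne true  y z = not (y ∨ z)
exactlyOne false true  z = not z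
exactlyOne false false z = z

majority : Bool → Bool → Bool → Bool
majority a b c = (a ∧ b) ∨ (a ∧ c) ∨ (b ∧ c)

TwoOf : (a b c : Bool) → Set
TwoOf a b c = (a ≡ true × b ≡ true) ⊎ (a ≡ true × c ≡ true) ⊎ (b ≡ true × c ≡ true)

majority⁺ : ∀ a b c → TwoOf a b c → majority a b c ≡ true
majority⁺ = toWitness {a? = allᵇ? λ a → allᵇ? λ b → allᵇ? λ c →
  ((_ Bool.≟ _ ×-dec _ Bool.≟ _) ⊎-dec (_ Bool.≟ _ ×-dec _ Bool.≟ _) ⊎-dec (_ Bool.≟ _ ×-dec _ Bool.≟ _))
  →-dec (_ Bool.≟ _)} _

majority⁻ : ∀ a b c → majority a b c ≡ true → TwoOf a b c
majority⁻ = toWitness {a? = allᵇ? λ a → allᵇ? λ b → allᵇ? λ c →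
  (_ Bool.≟ _) →-dec
  ((_ Bool.≟ _ ×-dec _ Bool.≟ _) ⊎-dec (_ Bool.≟ _ ×-dec _ Bool.≟ _) ⊎-dec (_ Bool.≟ _ ×-dec _ Bool.≟ _))} _

record Partition {n} (X Y Z : Fin n → Bool) : Set where
  constructor partition
  field exactly : ∀ i → exactlyOne (X i) (Y i) (Z i) ≡ true

open Partition

exactlyOne⁻ : ∀ x y z → exactlyOne x y z ≡ true →
  (y ≡ true → not x ≡ true) × (z ≡ true → not x ≡ true) × (z ≡ true → not y ≡ true) ×
  (not x ≡ true → y ∨ z ≡ true)
exactlyOne⁻ = toWitness {a? = allᵇ? λ x → allᵇ? λ y → allᵇ? λ z → (_ Bool.≟ _) →-dec
  (((_ Bool.≟ _) →-dec (_ Bool.≟ _)) ×-dec ((_ Bool.≟ _) →-dec (_ Bool.≟ _)) ×-dec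
   ((_ Bool.≟ _) →-dec (_ Bool.≟ _)) ×-dec ((_ Bool.≟ _) →-dec (_ Bool.≟ _)))} _

∁∁⊑ : ∀ {n} (X : Fin n → Bool) → ∁ (∁ X) ⊑ X
∁∁⊑ X = ≗⇒⊑ (λ i → not-involutive (X i))

⊑∁∁ : ∀ {n} (X : Fin n → Bool) → X ⊑ ∁ (∁ X)
⊑∁∁ X = ≗⇒⊑ (λ i → sym (not-involutive (X i)))

∁-antitone : ∀ {n} {X Y : Fin n → Bool} → X ⊑ Y → ∁ Y ⊑ ∁ X
∁-antitone {X = X} X⊑Y i h = not-true⁺ (¬true⇒false λ Xi → true≢false (X⊑Y i Xi) (not-true⁻ h))

∁-flip : ∀ {n} {X Y : Fin n → Bool} → X ⊑ ∁ Y → Y ⊑ ∁ X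
∁-flip {Y = Y} X⊑∁Y i = ∁-antitone X⊑∁Y i ∘ ⊑∁∁ Y i

module _ {n} {X Y Z : Fin n → Bool} (tri : Partition X Y Z) where

  second⊑∁first : Y ⊑ ∁ X
  second⊑∁first i = proj₁ (exactlyOne⁻ (X i) (Y i) (Z i) (exactly tri i))

  third⊑∁first : Z ⊑ ∁ X
  third⊑∁first i = proj₁ (proj₂ (exactlyOne⁻ (X i) (Y i) (Z i) (exactly tri i)))

  third⊑∁second : Z ⊑ ∁ Y
  third⊑∁second i = proj₁ (proj₂ (proj₂ (exactlyOne⁻ (X i) (Y i) (Z i) (exactly tri i))))

  ∁first⊑second∪third : ∁ X ⊑ Y ∪ Z
  ∁first⊑second∪third i = proj₂ (proj₂ (proj₂ (exactlyOne⁻ (X i) (Y i) (Z i) (exactly tri i))))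

module _ {n} {X Y Z : Fin n → Bool} where

  partition-swap : Partition X Y Z → Partition X Z Y
  partition-swap tri = partition λ i → swap (X i) (Y i) (Z i) (exactly tri i)
    where
    swap : ∀ x y z → exactlyOne x y z ≡ true → exactlyOne x z y ≡ true
    swap = toWitness {a? = allᵇ? λ x → allᵇ? λ y → allᵇ? λ z → (_ Bool.≟ _) →-dec (_ Bool.≟ _)} _

  partition-rotate : Partition (∁ X) Y Z → Partition (∁ (∁ Y)) (∁ X) Z
  partition-rotate tri = partition λ i → rotate (X i) (Y i) (Z i) (exactly tri i)
    where
    rotate : ∀ x y z → exactlyOne (not x) y z ≡ true → exactlyOne (not (not y)) (not x) z ≡ true
    rotate = toWitness {a? = allᵇ? λ x → allᵇ? λ y → allᵇ? λ z → (_ Bool.≟ _) →-dec (_ Bool.≟ _)} _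

partition-∁ : ∀ {n} (X : Fin n → Bool) → Partition (∁ X) X ∅
partition-∁ X = partition (one ∘ X)
  where
  one : ∀ x → exactlyOne (not x) x false ≡ true
  one true  = refl
  one false = refl

-- Boundaries and tangles of edge sets

module Hypergraph {m n : ℕ} (inc : Fin m → Fin n → Bool) where

  ESet : Set
  ESet = Fin m → Bool

  touch : ESet → Fin n → Bool
  touch X v = any (λ e → X e ∧ inc e v)

  touch⁺ : ∀ {X e v} → X e ≡ true → inc e v ≡ true → touch X v ≡ true
  touch⁺ {X} {e} {v} Xe ev = any⁺ _ e (∧-true⁺ Xe ev)

  touch⁻ : ∀ {X v} → touch X v ≡ true → ∃ λ e → X e ≡ true × inc e v ≡ true
  touch⁻ {X} {v} h with any⁻ (λ e → X e ∧ inc e v) h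
  ... | e , p = e , ∧-true⁻ p

  ¬touch-∅ : ∀ v → ¬ touch ∅ v ≡ true
  ¬touch-∅ v h with touch⁻ {∅} {v} h
  ... | _ , () , _

  touch-mono : ∀ {X Y} → X ⊑ Y → touch X ⊑ touch Y
  touch-mono {X} X⊑Y v h with touch⁻ {X} h
  ... | e , Xe , ev = touch⁺ (X⊑Y e Xe) ev

  touch-cong : ∀ {X Y} → X ≗ Y → touch X ≗ touch Y
  touch-cong eq = ⊑-antisym (touch-mono (≗⇒⊑ eq)) (touch-mono (≗⇒⊑ (sym ∘ eq)))

  touch-∪⁻ : ∀ {X Y v} → touch (X ∪ Y) v ≡ true → touch X v ≡ true ⊎ touch Y v ≡ true
  touch-∪⁻ {X} {Y} {v} h with touch⁻ {X ∪ Y} h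
  ... | e , XYe , ev with ∨-true⁻ {X e} XYe
  ...   | inj₁ Xe = inj₁ (touch⁺ Xe ev)
  ...   | inj₂ Ye = inj₂ (touch⁺ Ye ev)

  touch-∪ : ∀ X Y v → touch (X ∪ Y) v ≡ touch X v ∨ touch Y v
  touch-∪ X Y = ⊑-antisym to from
    where
    to : touch (X ∪ Y) ⊑ touch X ∪ touch Y
    to v h = [ ∨-true⁺ˡ , ∨-true⁺ʳ {touch X v} ]′ (touch-∪⁻ {X} {Y} h)
    from : touch X ∪ touch Y ⊑ touch (X ∪ Y)
    from v h with ∨-true⁻ {touch X v} h
    ... | inj₁ tX = touch-mono (λ _ → ∨-true⁺ˡ) v tX
    ... | inj₂ tY = touch-mono {Y} (λ e → ∨-true⁺ʳ {X e}) v tY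

  touch-∪₃ : ∀ X Y Z v → touch (X ∪ Y ∪ Z) v ≡ touch X v ∨ touch Y v ∨ touch Z v
  touch-∪₃ X Y Z v = trans (touch-∪ X (Y ∪ Z) v) (cong (touch X v ∨_) (touch-∪ Y Z v))

  touch-∪₄ : ∀ X Y Z W v →
             touch (X ∪ Y ∪ Z ∪ W) v ≡ touch X v ∨ touch Y v ∨ touch Z v ∨ touch W v
  touch-∪₄ X Y Z W v = trans (touch-∪ X (Y ∪ Z ∪ W) v) (cong (touch X v ∨_) (touch-∪₃ Y Z W v))

  touch-∪₅ : ∀ X Y Z W V v → touch (X ∪ Y ∪ Z ∪ W ∪ V) v ≡
             touch X v ∨ touch Y v ∨ touch Z v ∨ touch W v ∨ touch V v
  touch-∪₅ X Y Z W V v =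
    trans (touch-∪ X (Y ∪ Z ∪ W ∪ V) v) (cong (touch X v ∨_) (touch-∪₄ Y Z W V v))

  δ : ESet → Fin n → Bool
  δ X v = touch X v ∧ touch (∁ X) v

  -- The bag of a tree node at which three branches with edge sets `X`, `Y`, `Z` meet: a vertex
  -- belongs to it when two branches need it.
  δ₃ : ESet → ESet → ESet → Fin n → Bool
  δ₃ X Y Z v = majority (touch X v) (touch Y v) (touch Z v)

  δ₃⁺ : ∀ X Y Z v → TwoOf (touch X v) (touch Y v) (touch Z v) → δ₃ X Y Z v ≡ true
  δ₃⁺ X Y Z v = majority⁺ (touch X v) (touch Y v) (touch Z v)

  δ₃⁻ : ∀ X Y Z v → δ₃ X Y Z v ≡ true → TwoOf (touch X v) (touch Y v) (touch Z v)
  δ₃⁻ X Y Z v = majority⁻ (touch X v) (touch Y v) (touch Z v)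

  δ₃-mono : ∀ {X Y Z X′ Y′ Z′} → X ⊑ X′ → Y ⊑ Y′ → Z ⊑ Z′ → δ₃ X Y Z ⊑ δ₃ X′ Y′ Z′
  δ₃-mono {X} {Y} {Z} {X′} {Y′} {Z′} X⊑ Y⊑ Z⊑ v h =
    δ₃⁺ X′ Y′ Z′ v (Sum.map (Product.map (touch-mono X⊑ v) (touch-mono Y⊑ v))
      (Sum.map (Product.map (touch-mono X⊑ v) (touch-mono Z⊑ v))
               (Product.map (touch-mono Y⊑ v) (touch-mono Z⊑ v))) (δ₃⁻ X Y Z v h))

  δ₃-swap : ∀ X Y Z → δ₃ X Z Y ⊑ δ₃ X Y Z
  δ₃-swap X Y Z v h with δ₃⁻ X Z Y v h
  ... | inj₁ p               = δ₃⁺ X Y Z v (inj₂ (inj₁ p))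
  ... | inj₂ (inj₁ p)        = δ₃⁺ X Y Z v (inj₁ p)
  ... | inj₂ (inj₂ (p , q)) = δ₃⁺ X Y Z v (inj₂ (inj₂ (q , p)))

  -- Serves to change the root at a node: once `∁ Y` is the set being split, the part outside it is
  -- `∁ (∁ Y)`.
  δ₃-rotate : ∀ X Y Z → δ₃ (∁ (∁ Y)) X Z ⊑ δ₃ X Y Z
  δ₃-rotate X Y Z v h with δ₃⁻ (∁ (∁ Y)) X Z v h
  ... | inj₁ (p , q)        = δ₃⁺ X Y Z v (inj₁ (q , touch-mono (∁∁⊑ Y) v p))
  ... | inj₂ (inj₁ (p , q)) = δ₃⁺ X Y Z v (inj₂ (inj₂ (touch-mono (∁∁⊑ Y) v p , q)))
  ... | inj₂ (inj₂ p)       = δ₃⁺ X Y Z v (inj₂ (inj₁ p))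

  δ-cong : ∀ {X Y} → X ≗ Y → δ X ≗ δ Y
  δ-cong eq v = cong₂ _∧_ (touch-cong eq v) (touch-cong (cong not ∘ eq) v)

  δ-∁ : ∀ X → δ (∁ X) ⊑ δ X
  δ-∁ X v h with ∧-true⁻ {touch (∁ X) v} h
  ... | p , q = ∧-true⁺ (trans (sym (touch-cong (λ e → not-involutive (X e)) v)) q) p

  -- Checked vertex by vertex, by a truth table over the six sets into which F cuts the three parts.
  submodular₃ : ∀ X Y Z F → Partition (∁ X) Y Z →
    count (δ₃ (∁ (X ∖ F)) (Y ∖ F) (Z ∖ F)) +ℕ count (δ (∁ X ∩ F)) ≤
    count (δ₃ (∁ X) Y Z) +ℕ count (δ F)
  submodular₃ X Y Z F tri = count-mono₂ pointwise
    where
    x₁ x₀ y₁ y₀ z₁ z₀ : ESet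
    x₁ = ∁ X ∩ F
    x₀ = ∁ X ∖ F
    y₁ = Y ∩ F
    y₀ = Y ∖ F
    z₁ = Z ∩ F
    z₀ = Z ∖ F

    table : ∀ a₁ a₀ b₁ b₀ c₁ c₀ →
      bit (majority (a₁ ∨ a₀ ∨ b₁ ∨ c₁) b₀ c₀) +ℕ bit (a₁ ∧ (a₀ ∨ b₁ ∨ b₀ ∨ c₁ ∨ c₀)) ≤
      bit (majority (a₁ ∨ a₀) (b₁ ∨ b₀) (c₁ ∨ c₀)) +ℕ bit ((a₁ ∨ b₁ ∨ c₁) ∧ (a₀ ∨ b₀ ∨ c₀))
    table = toWitness {a? = allᵇ? λ a₁ → allᵇ? λ a₀ → allᵇ? λ b₁ → allᵇ? λ b₀ → allᵇ? λ c₁ →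
      allᵇ? λ c₀ → _ ≤? _} _

    eq₁ : ∀ x y z f → exactlyOne (not x) y z ≡ true →
      not (x ∧ not f) ≡ (not x ∧ f) ∨ (not x ∧ not f) ∨ (y ∧ f) ∨ (z ∧ f)
    eq₁ = toWitness {a? = allᵇ? λ x → allᵇ? λ y → allᵇ? λ z → allᵇ? λ f →
      (_ Bool.≟ _) →-dec (_ Bool.≟ _)} _

    eq₂ : ∀ x y z f → exactlyOne (not x) y z ≡ true →
      not (not x ∧ f) ≡ (not x ∧ not f) ∨ (y ∧ f) ∨ (y ∧ not f) ∨ (z ∧ f) ∨ (z ∧ not f)
    eq₂ = toWitness {a? = allᵇ? λ x → allᵇ? λ y → allᵇ? λ z → allᵇ? λ f →
      (_ Bool.≟ _) →-dec (_ Bool.≟ _)} _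

    eq₃ : ∀ x f → x ≡ (x ∧ f) ∨ (x ∧ not f)
    eq₃ = toWitness {a? = allᵇ? λ x → allᵇ? λ f → _ Bool.≟ _} _

    eq₄ : ∀ x y z f → exactlyOne (not x) y z ≡ true →
      f ≡ (not x ∧ f) ∨ (y ∧ f) ∨ (z ∧ f)
    eq₄ = toWitness {a? = allᵇ? λ x → allᵇ? λ y → allᵇ? λ z → allᵇ? λ f →
      (_ Bool.≟ _) →-dec (_ Bool.≟ _)} _

    pointwise : ∀ v →
      bit (δ₃ (∁ (X ∖ F)) (Y ∖ F) (Z ∖ F) v) +ℕ bit (δ (∁ X ∩ F) v) ≤
      bit (δ₃ (∁ X) Y Z v) +ℕ bit (δ F v)
    pointwise v
      rewrite trans (touch-cong (λ e → eq₁ (X e) (Y e) (Z e) (F e) (exactly tri e)) v) (touch-∪₄ x₁ x₀ y₁ z₁ v)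
            | trans (touch-cong (λ e → eq₂ (X e) (Y e) (Z e) (F e) (exactly tri e)) v)
                    (touch-∪₅ x₀ y₁ y₀ z₁ z₀ v)
            | trans (touch-cong {∁ X} (λ e → eq₃ (not (X e)) (F e)) v) (touch-∪ x₁ x₀ v)
            | trans (touch-cong {Y} (λ e → eq₃ (Y e) (F e)) v) (touch-∪ y₁ y₀ v)
            | trans (touch-cong {Z} (λ e → eq₃ (Z e) (F e)) v) (touch-∪ z₁ z₀ v)
            | trans (touch-cong {F} (λ e → eq₄ (X e) (Y e) (Z e) (F e) (exactly tri e)) v)
                    (touch-∪₃ x₁ y₁ z₁ v)
            | trans (touch-cong {∁ F} (λ e → eq₄ (X e) (Y e) (Z e) (not (F e)) (exactly tri e)) v)
                    (touch-∪₃ x₀ y₀ z₀ v)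
      = table (touch x₁ v) (touch x₀ v) (touch y₁ v) (touch y₀ v) (touch z₁ v) (touch z₀ v)

  -- X is a union of edge sets of components of the hypergraph minus S, up to edges inside S.
  Clopen : (Fin n → Bool) → ESet → Set
  Clopen S X = ∀ {v e e′} → X e ≡ true → X e′ ≡ false →
               inc e v ≡ true → inc e′ v ≡ true → S v ≡ true

  clopen-mono : ∀ {S S′ X} → S ⊑ S′ → Clopen S X → Clopen S′ X
  clopen-mono S⊑ cX p q i j = S⊑ _ (cX p q i j)

  clopen-∅ : ∀ {S} → Clopen S ∅
  clopen-∅ ()

  clopen-touch : ∀ {S X} → touch X ⊑ S → Clopen S X
  clopen-touch tX p _ i _ = tX _ (touch⁺ p i)

  clopen-∁ : ∀ {S X} → Clopen S X → Clopen S (∁ X)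
  clopen-∁ {X = X} cX p q i j = cX (¬false⇒true (λ h → true≢false (not-true⁺ h) q)) (not-true⁻ p) j i

  clopen-∪ : ∀ {S X Y} → Clopen S X → Clopen S Y → Clopen S (X ∪ Y)
  clopen-∪ {X = X} {Y} cX cY {v} {e} {e′} p q i j with ∨-true⁻ {X e} p
  ... | inj₁ Xe = cX Xe (¬true⇒false λ h → true≢false (∨-true⁺ˡ h) q) i j
  ... | inj₂ Ye = cY Ye (¬true⇒false λ h → true≢false (∨-true⁺ʳ {X e′} h) q) i j

  clopen-∖ : ∀ {S X Y} → Clopen S X → Clopen S Y → Clopen S (X ∖ Y)
  clopen-∖ {X = X} {Y} cX cY {v} {e} {e′} p q i j with ∧-true⁻ {X e} p | true⊎false (X e′)
  ... | Xe , Ye | inj₂ X′ = cX Xe X′ i j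
  ... | Xe , Ye | inj₁ X′ =
    cY (¬false⇒true λ h → true≢false (∧-true⁺ X′ (not-true⁺ h)) q) (not-true⁻ Ye) j i

  apart : ∀ {S P Q v} → (∀ e → Q e ≡ true → P e ≡ false) → Clopen S P →
          touch P v ≡ true → touch Q v ≡ true → S v ≡ true
  apart {P = P} {Q} disj cP p q with touch⁻ {P} p | touch⁻ {Q} q
  ... | e , Pe , i | e′ , Qe , j = cP Pe (disj e′ Qe) i j

  clopen⇒δ₃ : ∀ {S X Y Z} → Partition X Y Z → Clopen S X → Clopen S Y → δ₃ X Y Z ⊑ S
  clopen⇒δ₃ {S} {X} {Y} {Z} tri cX cY v h with δ₃⁻ X Y Z v h
  ... | inj₁ (p , q)        = apart (λ e → not-true⁻ ∘ second⊑∁first tri e) cX p q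
  ... | inj₂ (inj₁ (p , q)) = apart (λ e → not-true⁻ ∘ third⊑∁first tri e) cX p q
  ... | inj₂ (inj₂ (p , q)) = apart (λ e → not-true⁻ ∘ third⊑∁second tri e) cY p q

  clopen⇒δ : ∀ {S X} → Clopen S X → δ X ⊑ S
  clopen⇒δ {S} {X} cX v h with ∧-true⁻ {touch X v} h
  ... | p , q = apart {P = X} (λ e → not-true⁻) cX p q

  -- Over each `S` of fewer than `a` vertices the small clopen sets form an ideal, proper because
  -- `full` is large. So a clopen set and its complement are never both small.
  record Tangle (a : ℕ) : Set where
    field
      small      : ESet → Bool
      small-⊑    : ∀ {X Y} → X ⊑ Y → small Y ≡ true → small X ≡ true
      small-bag  : ∀ {X} → count (touch X) < a → small X ≡ true
      small-∪    : ∀ {S X Y} → count S < a → Clopen S X → Clopen S Y →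
                   small X ≡ true → small Y ≡ true → small (X ∪ Y) ≡ true
      full-large : small full ≡ false

-- Duality between tangles and derivations

module Duality {m n : ℕ} (inc : Fin m → Fin n → Bool) (k : ℕ) where
  open Hypergraph inc

  Family : Set
  Family = ESet → Bool

  -- A derivation is one branch of a decomposition: `X` is split, `∁ X` stands for the rest of the
  -- tree, and `δ₃` is the bag. A leaf has an empty third part so that leaves and nodes obey the
  -- same bound.
  data Derivable (I : Family) (X : ESet) : Set where
    leaf : I X ≡ true → count (δ₃ (∁ X) X ∅) ≤ k → Derivable I X
    node : ∀ {Y Z} → Partition (∁ X) Y Z → count (δ₃ (∁ X) Y Z) ≤ k →
           Derivable I Y → Derivable I Z → Derivable I X

  record IsIdeal (I : Family) : Set where
    field
      ⊑-closed : ∀ {X Y} → X ⊑ Y → I Y ≡ true → I X ≡ true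
      small    : ∀ {X} → count (touch X) ≤ k → I X ≡ true

    ∅∈ : I ∅ ≡ true
    ∅∈ = small (subst (_≤ k) (sym (count-none none)) z≤n)
      where
      none : ∀ v → touch ∅ v ≡ false
      none v = ¬true⇒false (¬touch-∅ v)

  module _ {I : Family} (ideal : IsIdeal I) where
    open IsIdeal ideal

    Derivable-resp : ∀ {X X′} → X ≗ X′ → Derivable I X → Derivable I X′
    Derivable-resp {X} {X′} eq (leaf IX c) =
      leaf (⊑-closed (≗⇒⊑ (sym ∘ eq)) IX)
           (ℕ.≤-trans (count-mono (δ₃-mono {Z = ∅} (∁-antitone (≗⇒⊑ eq)) (≗⇒⊑ (sym ∘ eq)) (λ _ p → p))) c)
    Derivable-resp {X} {X′} eq (node {Y} {Z} tri c dY dZ) =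
      node (partition λ e → subst (λ x → exactlyOne (not x) (Y e) (Z e) ≡ true) (eq e) (exactly tri e))
           (ℕ.≤-trans (count-mono (δ₃-mono {Y = Y} {Z} (∁-antitone (≗⇒⊑ eq)) (λ _ p → p) (λ _ p → p))) c)
           dY dZ

    Derivable⇒δ≤ : ∀ {X} → Derivable I X → count (δ X) ≤ k
    Derivable⇒δ≤ {X} (leaf _ c) = ℕ.≤-trans (count-mono δ⊑) c
      where
      δ⊑ : δ X ⊑ δ₃ (∁ X) X ∅
      δ⊑ v h with ∧-true⁻ {touch X v} h
      ... | p , q = δ₃⁺ (∁ X) X ∅ v (inj₁ (q , p))
    Derivable⇒δ≤ {X} (node {Y} {Z} tri c _ _) = ℕ.≤-trans (count-mono δ⊑) c
      where
      δ⊑ : δ X ⊑ δ₃ (∁ X) Y Z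
      δ⊑ v h with ∧-true⁻ {touch X v} h
      ... | p , q with touch-∪⁻ {Y} {Z} (touch-mono (λ e → ∁first⊑second∪third tri e ∘ ⊑∁∁ X e) v p)
      ...   | inj₁ y = δ₃⁺ (∁ X) Y Z v (inj₁ (q , y))
      ...   | inj₂ z = δ₃⁺ (∁ X) Y Z v (inj₂ (inj₁ (q , z)))

    -- By submodularity, cutting off F does not enlarge any boundary in the derivation, because
    -- δ F is smallest among the sets between A and F.
    push : ∀ {A} F → (∀ F′ → A ⊑ F′ → F′ ⊑ F → count (δ F) ≤ count (δ F′)) → A ⊑ F →
           ∀ {X} → A ⊑ ∁ X → Derivable I X → Derivable I (X ∖ F)
    push {A} F min A⊑F = go
      where
      bound : ∀ {X Y Z} → A ⊑ ∁ X → Partition (∁ X) Y Z → count (δ₃ (∁ X) Y Z) ≤ k →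
              count (δ₃ (∁ (X ∖ F)) (Y ∖ F) (Z ∖ F)) ≤ k
      bound {X} {Y} {Z} A⊑∁X tri c = ℕ.+-cancelʳ-≤ (count (δ F)) _ _ (begin
        count (δ₃ (∁ (X ∖ F)) (Y ∖ F) (Z ∖ F)) +ℕ count (δ F)
          ≤⟨ ℕ.+-monoʳ-≤ (count (δ₃ (∁ (X ∖ F)) (Y ∖ F) (Z ∖ F)))
               -- `∁ X ∩ F` contains `A` because `X` avoids `A`, so it competes with `F` for the
               -- smallest boundary.
               (min (∁ X ∩ F) (λ e p → ∧-true⁺ (A⊑∁X e p) (A⊑F e p))
                             (λ e p → proj₂ (∧-true⁻ {not (X e)} p))) ⟩
        count (δ₃ (∁ (X ∖ F)) (Y ∖ F) (Z ∖ F)) +ℕ count (δ (∁ X ∩ F))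
          ≤⟨ submodular₃ X Y Z F tri ⟩
        count (δ₃ (∁ X) Y Z) +ℕ count (δ F)
          ≤⟨ ℕ.+-monoˡ-≤ (count (δ F)) c ⟩
        k +ℕ count (δ F) ∎)
        where open ℕ.≤-Reasoning

      tri∖ : ∀ x y z f → exactlyOne (not x) y z ≡ true →
             exactlyOne (not (x ∧ not f)) (y ∧ not f) (z ∧ not f) ≡ true
      tri∖ = toWitness {a? = allᵇ? λ x → allᵇ? λ y → allᵇ? λ z → allᵇ? λ f →
               (_ Bool.≟ _) →-dec (_ Bool.≟ _)} _

      go : ∀ {X} → A ⊑ ∁ X → Derivable I X → Derivable I (X ∖ F)
      go {X} A⊑∁X (leaf IX c) =
        leaf (⊑-closed (λ e → proj₁ ∘ ∧-true⁻ {X e}) IX) (bound A⊑∁X (partition-∁ X) c)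
      go {X} A⊑∁X (node {Y} {Z} tri c dY dZ) =
        node (partition λ e → tri∖ (X e) (Y e) (Z e) (F e) (exactly tri e)) (bound A⊑∁X tri c)
             (go (λ e → ∁-flip (second⊑∁first tri) e ∘ A⊑∁X e) dY)
             (go (λ e → ∁-flip (third⊑∁first tri) e ∘ A⊑∁X e) dZ)

    -- Nothing lies outside `full`, so the bag of this split is just the boundary of `F`.
    glue : ∀ F → count (δ F) ≤ k → Derivable I F → Derivable I (∁ F) → Derivable I full
    glue F c dF dF′ = node (partition (tri ∘ F)) (ℕ.≤-trans (count-mono δ₃⊑) c) dF dF′
      where
      tri : ∀ f → exactlyOne false f (not f) ≡ true
      tri true  = refl
      tri false = refl
      δ₃⊑ : δ₃ (∁ full) F (∁ F) ⊑ δ F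
      δ₃⊑ v h with δ₃⁻ ∅ F (∁ F) v h
      ... | inj₁ (p , q)        = ⊥-elim (¬touch-∅ v p)
      ... | inj₂ (inj₁ (p , q)) = ⊥-elim (¬touch-∅ v p)
      ... | inj₂ (inj₂ (p , q)) = ∧-true⁺ p q

    -- F separates A from B with the smallest boundary; each derivation is cut off at F.
    merge : ∀ {A B} → A ⊑ ∁ B → Derivable I (∁ A) → Derivable I (∁ B) → ¬ ¬ Derivable I full
    merge {A} {B} A⊑∁B dA dB ¬d = <-rec P step _ A (λ _ p → p) A⊑∁B refl
      where
      P : ℕ → Set
      P c = ∀ F → A ⊑ F → F ⊑ ∁ B → count (δ F) ≡ c → ⊥
      step : ∀ c → (∀ {c′} → c′ < c → P c′) → P c
      step _ rec F A⊑F F⊑∁B refl = ¬d (glue F δF≤k dF dF′)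
        where
        min : ∀ F′ → A ⊑ F′ → F′ ⊑ ∁ B → count (δ F) ≤ count (δ F′)
        -- A set with smaller boundary is refuted by the induction; this descent starts at `A`, and
        -- `F` may be taken as a minimiser.
        min F′ p q = ℕ.≮⇒≥ λ lt → rec lt F′ p q refl
        δF≤k : count (δ F) ≤ k
        δF≤k = ℕ.≤-trans (min A (λ _ p → p) A⊑∁B) (ℕ.≤-trans (count-mono δA⊑) (Derivable⇒δ≤ dA))
          where
          δA⊑ : δ A ⊑ δ (∁ A)
          δA⊑ v h = δ-∁ (∁ A) v (trans (δ-cong (not-involutive ∘ A) v) h)
        min′ : ∀ F′ → B ⊑ F′ → F′ ⊑ ∁ F → count (δ (∁ F)) ≤ count (δ F′)
        min′ F′ B⊑F′ F′⊑∁F =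
          ℕ.≤-trans (count-mono (δ-∁ F))
            (ℕ.≤-trans (min (∁ F′) (λ e → ∁-flip F′⊑∁F e ∘ A⊑F e) (∁-antitone B⊑F′))
              (count-mono (δ-∁ F′)))
        dF′ : Derivable I (∁ F)
        -- Since `A` lies in `F`, cutting `F` off `∁ A` leaves `∁ F`. In the same way, cutting `∁ F`
        -- off `∁ B` leaves `F`.
        dF′ = Derivable-resp (λ e → id₁ (A e) (F e) (A⊑F e))
                (push F (λ F′ p q → min F′ p (λ e → F⊑∁B e ∘ q e)) A⊑F
                  (λ e p → trans (not-involutive (A e)) p) dA)
          where
          id₁ : ∀ a f → (a ≡ true → f ≡ true) → not a ∧ not f ≡ not f
          id₁ = toWitness {a? = allᵇ? λ a → allᵇ? λ f →
                  ((_ Bool.≟ _) →-dec (_ Bool.≟ _)) →-dec (_ Bool.≟ _)} _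
        dF : Derivable I F
        dF = Derivable-resp (λ e → id₂ (B e) (F e) (F⊑∁B e))
               (push (∁ F) min′ (∁-flip F⊑∁B) (λ e p → trans (not-involutive (B e)) p) dB)
          where
          id₂ : ∀ b f → (f ≡ true → not b ≡ true) → not b ∧ not (not f) ≡ f
          id₂ = toWitness {a? = allᵇ? λ a → allᵇ? λ f →
                  ((_ Bool.≟ _) →-dec (_ Bool.≟ _)) →-dec (_ Bool.≟ _)} _

  -- Enlarging ideals up to maximality

  _≗?_ : (X Y : ESet) → Dec (X ≗ Y)
  X ≗? Y = Fin.all? λ e → X e Bool.≟ Y e

  adjoin : Family → ESet → Family
  adjoin I A X = I X ∨ does (X ≗? A)

  adjoin⁻ : ∀ {I A X} → adjoin I A X ≡ true → I X ≡ true ⊎ X ≗ A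
  adjoin⁻ {I} {A} {X} h with ∨-true⁻ {I X} h
  ... | inj₁ p = inj₁ p
  ... | inj₂ q = inj₂ (does⁻ (X ≗? A) q)

  -- Read a derivation tree with leaf A from A as its root; a marks the branch containing A.
  reroot : ∀ {I A a} → IsIdeal I → A a ≡ true → ∀ {X} → Derivable (adjoin I A) X →
           Derivable I X ⊎ (X a ≡ true × (Derivable I (∁ X) → Derivable I (∁ A)))
  reroot {I} {A} ideal Aa {X} (leaf IX c) with adjoin⁻ {I} {A} IX
  ... | inj₁ p = inj₁ (leaf p c)
  ... | inj₂ q = inj₂ (trans (q _) Aa , Derivable-resp ideal (cong not ∘ q))
  reroot {I} {A} {a} ideal Aa {X} (node {Y} {Z} tri c dY dZ) with reroot ideal Aa dY | reroot ideal Aa dZ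
  ... | inj₁ dY′ | inj₁ dZ′ = inj₁ (node tri c dY′ dZ′)
  -- Seen from the branch of `Y`, the set `∁ Y` splits into `∁ X` and `Z` over the same bag.
  ... | inj₂ (Ya , f) | inj₁ dZ′ = inj₂ (∁∁⊑ X a (second⊑∁first tri a Ya) ,
    λ dX → f (node (partition-rotate tri) (ℕ.≤-trans (count-mono (δ₃-rotate (∁ X) Y Z)) c) dX dZ′))
  ... | inj₁ dY′ | inj₂ (Za , f) = inj₂ (∁∁⊑ X a (third⊑∁first tri a Za) ,
    λ dX → f (node (partition-rotate (partition-swap tri))
      (ℕ.≤-trans (count-mono (δ₃-rotate (∁ X) Z Y)) (ℕ.≤-trans (count-mono (δ₃-swap (∁ X) Y Z)) c)) dX dY′))
  -- `A` cannot be used on both branches: `Y` and `Z` are disjoint, and `a` would lie in both.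
  ... | inj₂ (Ya , _) | inj₂ (Za , _) =
    ⊥-elim (true≢false Ya (not-true⁻ (third⊑∁second tri a Za)))

  count-∅≤ : count (∅ {n}) ≤ k
  count-∅≤ = subst (_≤ k) (sym (count-none {p = ∅ {n}} (λ _ → refl))) z≤n

  clopen-leaf : ∀ {S I X} → count S ≤ k → Clopen S X → I X ≡ true → Derivable I X
  clopen-leaf {X = X} c cX IX =
    leaf IX (ℕ.≤-trans (count-mono (clopen⇒δ₃ {Z = ∅} (partition-∁ X) (clopen-∁ cX) cX)) c)

  Minimal : Family → ESet → Set
  Minimal I A = ∀ {Y} → Y ⊑ A → Y ≗ A ⊎ I Y ≡ true

  remove : Fin m → ESet → ESet
  remove e X i = X i ∧ not (does (i Fin.≟ e))

  -- Remove edges one at a time while the set stays outside `I`. Testing single edges suffices,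
  -- since every proper subset misses some edge and `I` is closed under subsets.
  minimal-below : ∀ {I} → IsIdeal I → ∀ X → I X ≡ false →
                  ∃ λ A → A ⊑ X × I A ≡ false × Minimal I A
  minimal-below {I} ideal X IX = <-rec P step _ X IX refl
    where
    open IsIdeal ideal
    P : ℕ → Set
    P c = ∀ X → I X ≡ false → count X ≡ c → ∃ λ A → A ⊑ X × I A ≡ false × Minimal I A
    step : ∀ c → (∀ {c′} → c′ < c → P c′) → P c
    step _ rec X IX refl with Fin.any? (λ e → (X e Bool.≟ true) ×-dec (I (remove e X) Bool.≟ false))
    ... | yes (e , Xe , IX′) with rec (count-mono-< {p = remove e X} {X} (λ i → proj₁ ∘ ∧-true⁻ {X i}) e removed Xe)
                                         (remove e X) IX′ refl
      where
      removed : remove e X e ≡ false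
      removed rewrite dec-true (e Fin.≟ e) refl | Xe = refl
    ...   | A , A⊑ , IA , min = A , (λ i → proj₁ ∘ ∧-true⁻ {X i} ∘ A⊑ i) , IA , min
    step _ rec X IX refl | no none = X , (λ _ p → p) , IX , min
      where
      min : Minimal I X
      min {Y} Y⊑X with Fin.any? (λ e → (X e Bool.≟ true) ×-dec (Y e Bool.≟ false))
      ... | no  ¬e = inj₁ (⊑-antisym Y⊑X (λ e Xe → ¬false⇒true λ Ye → ¬e (e , Xe , Ye)))
      ... | yes (e , Xe , Ye) =
        inj₂ (⊑-closed Y⊑ (¬false⇒true λ IX′ → none (e , Xe , IX′)))
        where
        Y⊑ : Y ⊑ remove e X
        Y⊑ i Yi with i Fin.≟ e
        ... | yes refl = ⊥-elim (true≢false Yi Ye)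
        ... | no  _    = ∧-true⁺ (Y⊑X i Yi) refl

  -- Proper subsets of a minimal `A` lie in `I` already, which keeps the enlarged family closed
  -- under subsets.
  adjoin-ideal : ∀ {I A} → IsIdeal I → Minimal I A → IsIdeal (adjoin I A)
  adjoin-ideal {I} {A} ideal min = record
    { ⊑-closed = closed
    ; small    = ∨-true⁺ˡ ∘ small }
    where
    open IsIdeal ideal
    closed : ∀ {X Y} → X ⊑ Y → adjoin I A Y ≡ true → adjoin I A X ≡ true
    closed {X} {Y} X⊑Y h with adjoin⁻ {I} {A} {Y} h
    ... | inj₁ IY = ∨-true⁺ˡ (⊑-closed X⊑Y IY)
    ... | inj₂ eq with min {X} (λ e → ≗⇒⊑ eq e ∘ X⊑Y e)
    ...   | inj₁ eq′ = ∨-true⁺ʳ {I X} (dec-true (X ≗? A) eq′)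
    ...   | inj₂ IX  = ∨-true⁺ˡ IX

  -- Numbering the edge sets makes the sets outside an ideal countable by `count`; their number is
  -- the measure for enlarging ideals.
  decode : Fin (2 ^ m) → ESet
  decode i e = does (finToFun {2} {m} i e Fin.≟ zero)

  encode : ESet → Fin (2 ^ m)
  encode X = funToFin {m} {2} λ e → if X e then zero else suc zero

  decode-encode : ∀ X → decode (encode X) ≗ X
  decode-encode X e rewrite Fin.finToFun-funToFin {m} {2} (λ e → if X e then zero else suc zero) e with X e
  ... | true  = refl
  ... | false = refl

  numberLarge : Family → ℕ
  numberLarge I = count (λ i → not (I (decode i)))

  adjoin-< : ∀ {I A} → IsIdeal I → I A ≡ false → numberLarge (adjoin I A) < numberLarge I
  adjoin-< {I} {A} ideal IA = count-mono-< weaker (encode A)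
    (cong not (∨-true⁺ʳ {I (decode (encode A))} (dec-true (decode (encode A) ≗? A) (decode-encode A))))
    (not-true⁺ (¬true⇒false λ h → true≢false (⊑-closed (≗⇒⊑ (sym ∘ decode-encode A)) h) IA))
    where
    open IsIdeal ideal
    weaker : (λ i → not (adjoin I A (decode i))) ⊑ (λ i → not (I (decode i)))
    weaker i h = not-true⁺ (¬true⇒false λ p → true≢false (∨-true⁺ˡ p) (not-true⁻ h))

  Intersecting : Family → Set
  Intersecting I = ∀ {X Y} → I X ≡ false → I Y ≡ false → ¬ X ⊑ ∁ Y

  -- Enlarge `I` by minimal sets outside it while `full` stays underivable. When `A` can no longer
  -- be adjoined, the resulting derivation, rerooted at `A`, derives `∁ A`. Disjoint sets outside
  -- `I` contain disjoint minimal ones, and merging their two derivations would derive `full`.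
  saturate : ∀ {I} → IsIdeal I → ¬ Derivable I full →
             ¬ ¬ ∃ λ J → IsIdeal J × ¬ Derivable J full × Intersecting J
  saturate {I} ideal ¬d none = <-rec P step _ I ideal ¬d refl
    where
    P : ℕ → Set
    P c = ∀ I → IsIdeal I → ¬ Derivable I full → numberLarge I ≡ c → ⊥
    step : ∀ c → (∀ {c′} → c′ < c → P c′) → P c
    step _ rec I ideal ¬d refl = none (I , ideal , ¬d , intersecting)
      where
      open IsIdeal ideal
      nonEmpty : ∀ {A} → I A ≡ false → ∃ λ a → A a ≡ true
      nonEmpty {A} IA with Fin.any? (λ e → A e Bool.≟ true)
      ... | yes p = p
      ... | no ¬p = ⊥-elim (true≢false (⊑-closed (λ e Ae → ⊥-elim (¬p (e , Ae))) ∅∈) IA)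

      complement : ∀ {A} → I A ≡ false → Minimal I A → ¬ ¬ Derivable I (∁ A)
      complement {A} IA min ¬dA =
        rec (adjoin-< ideal IA) (adjoin I A) (adjoin-ideal ideal min) ¬d′ refl
        where
        ∁full : Derivable I (∁ full)
        ∁full = clopen-leaf {∅} count-∅≤ clopen-∅ ∅∈
        ¬d′ : ¬ Derivable (adjoin I A) full
        ¬d′ d with reroot ideal (proj₂ (nonEmpty IA)) d
        ... | inj₁ dI = ¬d dI
        ... | inj₂ (_ , f) = ¬dA (f ∁full)

      intersecting : Intersecting I
      intersecting {X} {Y} IX IY X⊑∁Y with minimal-below ideal X IX | minimal-below ideal Y IY
      ... | A , A⊑X , IA , minA | B , B⊑Y , IB , minB =
        complement IA minA λ dA → complement IB minB λ dB →
          merge ideal (λ e → ∁-antitone B⊑Y e ∘ X⊑∁Y e ∘ A⊑X e) dA dB ¬d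

  tangle : ∀ {J} → IsIdeal J → ¬ Derivable J full → Intersecting J → Tangle (suc k)
  tangle {J} ideal ¬d meet = record
    { small      = J
    ; small-⊑    = ⊑-closed
    ; small-bag  = λ { (s≤s c) → small c }
    ; small-∪    = ∪-closed
    ; full-large = ¬true⇒false λ h → ¬d (clopen-leaf {∅} count-∅≤ (λ _ ()) h)
    }
    where
    open IsIdeal ideal
    ∪-closed : ∀ {S X Y} → count S < suc k → Clopen S X → Clopen S Y →
               J X ≡ true → J Y ≡ true → J (X ∪ Y) ≡ true
    -- If `X ∪ Y` were large, its complement would be small by `meet`. Then `X`, the rest of `Y` and
    -- that complement would be three leaves over `S`, and they would derive `full`.
    ∪-closed {S} {X} {Y} (s≤s c) cX cY JX JY = ¬false⇒true λ J∪ → ¬d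
      (glue ideal (X ∪ Y) (ℕ.≤-trans (count-mono (clopen⇒δ cX∪Y)) c)
        (node tri (ℕ.≤-trans (count-mono (clopen⇒δ₃ tri (clopen-∁ cX∪Y) cX)) c)
          (clopen-leaf c cX JX)
          (clopen-leaf c (clopen-∖ cY cX) (⊑-closed (λ e → proj₁ ∘ ∧-true⁻ {Y e}) JY)))
        (clopen-leaf c (clopen-∁ cX∪Y)
          (¬false⇒true λ J∁ → meet J∪ J∁ (λ e → trans (not-involutive ((X ∪ Y) e))))))
      where
      cX∪Y : Clopen S (X ∪ Y)
      cX∪Y = clopen-∪ cX cY
      tri : Partition (∁ (X ∪ Y)) X (Y ∖ X)
      tri = partition λ e → one (X e) (Y e)
        where
        one : ∀ x y → exactlyOne (not (x ∨ y)) x (y ∧ not x) ≡ true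
        one = toWitness {a? = allᵇ? λ x → allᵇ? λ y → _ Bool.≟ _} _

  initial : Family
  initial X = does (count (touch X) ≤? k)

  initial-ideal : IsIdeal initial
  initial-ideal = record
    { ⊑-closed = λ {X} {Y} X⊑Y h → dec-true (count (touch X) ≤? k)
        (ℕ.≤-trans (count-mono (touch-mono X⊑Y)) (does⁻ (count (touch Y) ≤? k) h))
    ; small = λ {X} → dec-true (count (touch X) ≤? k)
    }

  ¬derivable⇒tangle : ¬ Derivable initial full → ¬ ¬ Tangle (suc k)
  ¬derivable⇒tangle ¬d ¬t = saturate initial-ideal ¬d λ { (J , ideal , ¬dJ , meet) →
    ¬t (tangle ideal ¬dJ meet) }

-- From derivations to tree-decompositions

-- A pair (u , v) stands for the edge uv, or for the loop at u when u and v are not adjacent.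
incident : (G : Graph) → Vertex G × Vertex G → Vertex G → Bool
incident G (u , v) w = does (w Fin.≟ u) ∨ (does (w Fin.≟ v) ∧ does (Graph.adj? G u v))

opaque
  incidence : (G : Graph) → Fin (Graph.order G *ℕ Graph.order G) → Vertex G → Bool
  incidence G e = incident G (remQuot (Graph.order G) e)

  incidence-combine : ∀ G u v w → incidence G (combine u v) w ≡ incident G (u , v) w
  incidence-combine G u v w = cong (λ p → incident G p w) (Fin.remQuot-combine u v)

module Incidence (G : Graph) where
  open Graph G using (order; Adj; adj?; symm)

  source target : Fin (order *ℕ order) → Vertex G
  source e = proj₁ (remQuot {order} order e)
  target e = proj₂ (remQuot {order} order e)

  incident⁻ : ∀ u v {w} → incident G (u , v) w ≡ true → w ≡ u ⊎ (w ≡ v × Adj u v)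
  incident⁻ u v {w} h with ∨-true⁻ {does (w Fin.≟ u)} h
  ... | inj₁ p = inj₁ (does⁻ (w Fin.≟ u) p)
  ... | inj₂ q with ∧-true⁻ {does (w Fin.≟ v)} q
  ...   | p , r = inj₂ (does⁻ (w Fin.≟ v) p , does⁻ (adj? u v) r)

  incidence⁻ : ∀ e {w} → incidence G e w ≡ true → w ≡ source e ⊎ (w ≡ target e × Adj (source e) (target e))
  incidence⁻ e {w} h = incident⁻ (source e) (target e)
    (trans (sym (incidence-combine G (source e) (target e) w))
      (subst (λ e → incidence G e w ≡ true) (sym (Fin.combine-remQuot {order} order e)) h))

  incidence-adjacent : ∀ e {u v} → incidence G e u ≡ true → incidence G e v ≡ true → u ≡ v ⊎ Adj u v
  incidence-adjacent e eu ev with incidence⁻ e eu | incidence⁻ e ev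
  ... | inj₁ refl       | inj₁ refl       = inj₁ refl
  ... | inj₁ refl       | inj₂ (refl , a) = inj₂ a
  ... | inj₂ (refl , a) | inj₁ refl       = inj₂ (symm a)
  ... | inj₂ (refl , _) | inj₂ (refl , _) = inj₁ refl

  incidence-left : ∀ u v → incidence G (combine u v) u ≡ true
  incidence-left u v = trans (incidence-combine G u v u) (∨-true⁺ˡ (dec-true (u Fin.≟ u) refl))

  incidence-right : ∀ {u v} → Adj u v → incidence G (combine u v) v ≡ true
  incidence-right {u} {v} a = trans (incidence-combine G u v v)
    (∨-true⁺ʳ {does (v Fin.≟ u)} (∧-true⁺ (dec-true (v Fin.≟ v) refl) (dec-true (adj? u v) a)))

module AddLeaf (T : Graph) (t : Vertex T) where
  open Graph T using (order; Adj; adj?; symm; irrefl)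

  AdjL : Fin (suc order) → Fin (suc order) → Set
  AdjL zero    zero    = ⊥
  AdjL zero    (suc j) = j ≡ t
  AdjL (suc i) zero    = i ≡ t
  AdjL (suc i) (suc j) = Adj i j

  addLeaf : Graph
  addLeaf = record
    { order  = suc order
    ; Adj    = AdjL
    ; adj?   = λ { zero zero → no λ () ; zero (suc j) → j Fin.≟ t
                 ; (suc i) zero → i Fin.≟ t ; (suc i) (suc j) → adj? i j }
    ; symm   = λ { {zero} {suc j} p → p ; {suc i} {zero} p → p ; {suc i} {suc j} p → symm p }
    ; irrefl = λ { {zero} refl () ; {suc i} refl p → irrefl refl p }
    }

  connected-addLeaf : ∀ {P : Vertex addLeaf → Set} → InducesConnected T (P ∘ suc) →
                      (∀ {s} → P zero → P (suc s) → P (suc t)) → InducesConnected addLeaf P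
  connected-addLeaf {P} conn attach {zero}  {zero}  px py = ε
  connected-addLeaf {P} conn attach {zero}  {suc y} px py =
    (px , attach px py , refl) ◅ gmap suc (λ p → p) (conn (attach px py) py)
  connected-addLeaf {P} conn attach {suc x} {zero}  px py =
    gmap suc (λ p → p) (conn px (attach py px)) ◅◅ ((attach py px , py , refl) ◅ ε)
  connected-addLeaf {P} conn attach {suc x} {suc y} px py = gmap suc (λ p → p) (conn px py)

  -- The two neighbours on a cycle of the new vertex would both be t.
  acyclic-addLeaf : ¬ Cycle T → ¬ Cycle addLeaf
  acyclic-addLeaf acyclic C with Fin.any? (λ i → Cycle.c C i Fin.≟ zero)
  ... | no none = acyclic (record
    { k = k
    ; c = λ i → proj₁ (pred i)
    ; distinct = λ {i} {j} eq →
        distinct (trans (proj₂ (pred i)) (trans (cong suc eq) (sym (proj₂ (pred j)))))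
    ; step = λ i → subst₂ AdjL (proj₂ (pred (inject₁ i))) (proj₂ (pred (suc i))) (step i)
    ; close = subst₂ AdjL (proj₂ (pred (fromℕ (2 +ℕ k)))) (proj₂ (pred zero)) close
    })
    where
    open Cycle C
    pred : ∀ i → ∃ λ s → c i ≡ suc s
    pred i with c i in eq
    ... | zero  = ⊥-elim (none (i , eq))
    ... | suc s = s , refl
  ... | yes (i , ci) = twoNeighbours i ci
    where
    open Cycle C
    only : ∀ {x y} → x ≡ zero → AdjL x y → y ≡ suc t
    only {y = suc y} refl refl = refl
    only′ : ∀ {x y} → y ≡ zero → AdjL x y → x ≡ suc t
    only′ {suc x} refl refl = refl
    clash : ∀ {i j} → c i ≡ suc t → c j ≡ suc t → ¬ i ≡ j → ⊥
    clash p q i≢j = i≢j (distinct (trans p (sym q)))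
    twoNeighbours : ∀ i → c i ≡ zero → ⊥
    -- The positions before and after the new vertex are distinct because a cycle has at least three
    -- vertices.
    twoNeighbours zero ci = clash (only ci (step zero)) (only′ ci close) λ ()
    twoNeighbours (suc i) ci with view i
    ... | ‵fromℕ     = clash (only ci close) (only′ ci (step i)) λ ()
    -- Here the two neighbours sit at positions `j` and `j + 2`.
    ... | ‵inject₁ j = clash (only ci (step (suc j))) (only′ ci (step i)) λ eq →
      ℕ.<⇒≢ (ℕ.m<n⇒m<1+n (ℕ.n<1+n _)) (sym (trans (cong toℕ eq)
        (trans (Fin.toℕ-inject₁ (inject₁ j)) (Fin.toℕ-inject₁ j))))

  isTree-addLeaf : IsTree T → IsTree addLeaf
  isTree-addLeaf tree = record
    { nonEmpty = _
    ; connected = connected-addLeaf {U} (IsTree.connected tree) λ _ _ → _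
    ; acyclic = acyclic-addLeaf (IsTree.acyclic tree)
    }

module Assemble (G : Graph) (k : ℕ) where
  open Graph G using (order)
  open Incidence G
  open Hypergraph (incidence G)
  open Duality (incidence G) k

  record Partial : Set₁ where
    field
      T      : Graph
      isTree : IsTree T
      β      : Vertex T → Fin order → Bool
      conn   : ∀ v → InducesConnected T (λ t → β t v ≡ true)
      size   : ∀ t → count (β t) ≤ k

  open Partial

  attach : ∀ P t W → count W ≤ k → (∀ {v s} → W v ≡ true → β P s v ≡ true → β P t v ≡ true) → Partial
  attach P t W W≤k inherit = record
    { T      = addLeaf
    ; isTree = isTree-addLeaf (isTree P)
    ; β      = bag
    ; conn   = λ v → connected-addLeaf (conn P v) inherit
    ; size   = λ { zero → W≤k ; (suc s) → size P s }
    }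
    where
    open AddLeaf (T P) t
    bag : Vertex addLeaf → Fin order → Bool
    bag zero    = W
    bag (suc s) = β P s

  -- `new` limits which vertices the added bags may contain; this is what allows a second branch to
  -- be attached after the first.
  record Extension (P : Partial) (X : ESet) : Set₁ where
    field
      result : Partial
      old    : Vertex (T P) → Vertex (T result)
      old-β  : ∀ s v → β result (old s) v ≡ β P s v
      new    : ∀ s v → β result s v ≡ true → (∃ λ s′ → β P s′ v ≡ true) ⊎ touch X v ≡ true
      covers : ∀ e → X e ≡ true → ∃ λ s → ∀ v → incidence G e v ≡ true → β result s v ≡ true

  open Extension

  -- The hypothesis puts every vertex that a new bag shares with an old one into the bag at t, so
  -- attaching new nodes at t keeps the nodes of each vertex connected.
  extend : ∀ {X} → Derivable initial X → ∀ P t →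
           (∀ {v s} → touch X v ≡ true → β P s v ≡ true → β P t v ≡ true × touch (∁ X) v ≡ true) →
           Extension P X
  extend {X} (leaf IX _) P t inv = record
    { result = attach P t (touch X) (does⁻ (count (touch X) ≤? k) IX) (λ p q → proj₁ (inv p q))
    ; old    = suc
    ; old-β  = λ _ _ → refl
    ; new    = λ { zero v p → inj₂ p ; (suc s) v p → inj₁ (s , p) }
    ; covers = λ e Xe → zero , λ v ev → touch⁺ Xe ev
    }
  extend {X} (node {Y} {Z} tri c dY dZ) P t inv = record
    { result = result E₂
    ; old    = old E₂ ∘ old E₁ ∘ suc
    ; old-β  = λ s v → trans (old-β E₂ _ v) (old-β E₁ _ v)
    ; new    = λ s v p →
        [ (λ (s′ , q) → [ from₁ , inj₂ ∘ touch-mono Y⊑X v ]′ (new E₁ s′ v q))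
        , inj₂ ∘ touch-mono Z⊑X v ]′ (new E₂ s v p)
    ; covers = λ e Xe →
        [ (λ Ye → let s , f = covers E₁ e Ye in old E₂ s , λ v ev → trans (old-β E₂ s v) (f v ev))
        , covers E₂ e ]′ (X⊑Y∪Z e Xe)
    }
    where
    W : Fin order → Bool
    W = δ₃ (∁ X) Y Z
    X⊑Y∪Z : ∀ e → X e ≡ true → Y e ≡ true ⊎ Z e ≡ true
    X⊑Y∪Z e p = ∨-true⁻ {Y e} (∁first⊑second∪third tri e (⊑∁∁ X e p))
    Y⊑X : Y ⊑ X
    Y⊑X e = ∁∁⊑ X e ∘ second⊑∁first tri e
    Z⊑X : Z ⊑ X
    Z⊑X e = ∁∁⊑ X e ∘ third⊑∁first tri e
    Z⊑∁Y : Z ⊑ ∁ Y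
    Z⊑∁Y = third⊑∁second tri
    Y⊑∁Z : Y ⊑ ∁ Z
    Y⊑∁Z = ∁-flip Z⊑∁Y
    W⊑X : W ⊑ touch X
    W⊑X v h with δ₃⁻ (∁ X) Y Z v h
    ... | inj₁ (_ , q)        = touch-mono Y⊑X v q
    ... | inj₂ (inj₁ (_ , q)) = touch-mono Z⊑X v q
    ... | inj₂ (inj₂ (_ , q)) = touch-mono Z⊑X v q
    P₁ : Partial
    P₁ = attach P t W c λ p q → proj₁ (inv (W⊑X _ p) q)
    W∩Y : ∀ {v} → touch Y v ≡ true → W v ≡ true → touch (∁ Y) v ≡ true
    W∩Y {v} y h with δ₃⁻ (∁ X) Y Z v h
    ... | inj₁ (p , _)        = touch-mono (∁-antitone Y⊑X) v p
    ... | inj₂ (inj₁ (p , _)) = touch-mono (∁-antitone Y⊑X) v p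
    ... | inj₂ (inj₂ (_ , q)) = touch-mono Z⊑∁Y v q
    W∩Z : ∀ {v} → touch Z v ≡ true → W v ≡ true → touch (∁ Z) v ≡ true
    W∩Z {v} z h with δ₃⁻ (∁ X) Y Z v h
    ... | inj₁ (p , _)        = touch-mono (∁-antitone Z⊑X) v p
    ... | inj₂ (inj₁ (p , _)) = touch-mono (∁-antitone Z⊑X) v p
    ... | inj₂ (inj₂ (q , _)) = touch-mono Y⊑∁Z v q
    inY : ∀ {v s} → touch Y v ≡ true → β P₁ s v ≡ true → W v ≡ true
    inY {s = zero}      y p = p
    -- A vertex of `Y` in an old bag is touched by `∁ X` as well, so two of the three parts share
    -- it.
    inY {v} {s = suc s} y p = δ₃⁺ (∁ X) Y Z v (inj₁ (proj₂ (inv (touch-mono Y⊑X v y) p) , y))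
    inZ : ∀ {v s} → touch Z v ≡ true → β P₁ s v ≡ true → W v ≡ true
    inZ {s = zero}      z p = p
    inZ {v} {s = suc s} z p = δ₃⁺ (∁ X) Y Z v (inj₂ (inj₁ (proj₂ (inv (touch-mono Z⊑X v z) p) , z)))
    E₁ : Extension P₁ Y
    E₁ = extend dY P₁ zero λ {v} {s} y p → inY {s = s} y p , W∩Y y (inY {s = s} y p)
    inZ′ : ∀ {v s} → touch Z v ≡ true → β (result E₁) s v ≡ true → W v ≡ true
    inZ′ {v} {s} z p with new E₁ s v p
    ... | inj₁ (s′ , q) = inZ {s = s′} z q
    -- A vertex of `Z` in a bag added for `Y` is touched by both parts.
    ... | inj₂ y        = δ₃⁺ (∁ X) Y Z v (inj₂ (inj₂ (y , z)))
    E₂ : Extension (result E₁) Z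
    E₂ = extend dZ (result E₁) (old E₁ zero) λ {v} {s} z p →
      trans (old-β E₁ zero v) (inZ′ {s = s} z p) , W∩Z z (inZ′ {s = s} z p)
    from₁ : ∀ {v} → (∃ λ s → β P₁ s v ≡ true) → (∃ λ s → β P s v ≡ true) ⊎ touch X v ≡ true
    from₁ (zero , p)  = inj₂ (W⊑X _ p)
    from₁ (suc s , p) = inj₁ (s , p)

  ∣tabulate∣ : ∀ {n} (p : Fin n → Bool) → ∣ tabulate p ∣ ≡ count p
  ∣tabulate∣ {zero}  p = refl
  ∣tabulate∣ {suc n} p with p zero
  ... | true  = cong suc (∣tabulate∣ (p ∘ suc))
  ... | false = ∣tabulate∣ (p ∘ suc)

  ∈-tabulate⁺ : ∀ {n} {p : Fin n → Bool} {i} → p i ≡ true → i ∈ tabulate p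
  ∈-tabulate⁺ {p = p} {i} pi = Vec.lookup⇒[]= i (tabulate p) (trans (Vec.lookup∘tabulate p i) pi)

  ∈-tabulate⁻ : ∀ {n} {p : Fin n → Bool} {i} → i ∈ tabulate p → p i ≡ true
  ∈-tabulate⁻ {p = p} {i} i∈ = trans (sym (Vec.lookup∘tabulate p i)) (Vec.[]=⇒lookup i∈)

  derivable⇒treeDecomposition : Derivable initial full → Σ[ D ∈ TreeDecomposition G ] maxBagSize D ≤ k
  derivable⇒treeDecomposition d = D , max≤v⁺ z≤n (All.map⁺ {xs = allFin _} (All.tabulate λ {t} _ →
      subst (_≤ k) (sym (∣tabulate∣ (β (result E) t))) (size (result E) t)))
    where
    start : Partial
    start = record
      { T      = TreeDecomposition.T (oneBag G)
      ; isTree = TreeDecomposition.isTree (oneBag G)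
      ; β      = λ _ → ∅
      ; conn   = λ { _ () }
      ; size   = λ _ → count-∅≤
      }
    E : Extension start full
    E = extend d start zero λ { _ () }
    covering : ∀ {e u v} → incidence G e u ≡ true → incidence G e v ≡ true →
               ∃ λ t → u ∈ tabulate (β (result E) t) × v ∈ tabulate (β (result E) t)
    covering {e} eu ev with covers E e refl
    ... | t , f = t , ∈-tabulate⁺ (f _ eu) , ∈-tabulate⁺ (f _ ev)
    D : TreeDecomposition G
    D = record
      { T               = T (result E)
      ; isTree          = isTree (result E)
      ; β               = λ t → tabulate (β (result E) t)
      -- The pair `(v , v)` acts as a loop at `v`, so isolated vertices are covered too.
      ; vertexCovered   = λ v → Product.map₂ proj₁ (covering (incidence-left v v) (incidence-left v v))
      ; vertexConnected = λ v p q →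
          gmap (λ t → t) (λ { (a , b , c) → ∈-tabulate⁺ a , ∈-tabulate⁺ b , c })
            (conn (result E) v (∈-tabulate⁻ p) (∈-tabulate⁻ q))
      ; edgeCovered     = λ {u} {v} uv → covering (incidence-left u v) (incidence-right uv)
      }

  ¬¬tangle : (∀ (D : TreeDecomposition G) → k < maxBagSize D) → ¬ ¬ Tangle (suc k)
  ¬¬tangle large = ¬derivable⇒tangle λ d → let D , D≤k = derivable⇒treeDecomposition d in
    ℕ.<⇒≱ (large D) D≤k

-- The tangle of the product

count-++ : ∀ m {n} (S : Fin (m +ℕ n) → Bool) → count S ≡ count (S ∘ (_↑ˡ n)) +ℕ count (S ∘ (m ↑ʳ_))
count-++ zero    S = refl
count-++ (suc m) S = trans (cong (bit (S zero) +ℕ_) (count-++ m (S ∘ suc)))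
                           (sym (ℕ.+-assoc (bit (S zero)) _ _))

-- Markov's inequality for rows: each row counted on the left contains at least half of `b` elements
-- of `S`. Doubling the counts avoids halving `b`.
count-heavy : ∀ p {q} b (S : Fin (p *ℕ q) → Bool) →
              count (λ g → does (b ≤? 2 *ℕ count (λ h → S (combine {p} {q} g h)))) *ℕ b ≤ 2 *ℕ count S
count-heavy zero    b S = z≤n
count-heavy (suc p) {q} b S = begin
  (bit (does (b ≤? 2 *ℕ c)) +ℕ count heavy′) *ℕ b
    ≡⟨ ℕ.*-distribʳ-+ b (bit (does (b ≤? 2 *ℕ c))) (count heavy′) ⟩
  bit (does (b ≤? 2 *ℕ c)) *ℕ b +ℕ count heavy′ *ℕ b
    ≤⟨ ℕ.+-mono-≤ (first (b ≤? 2 *ℕ c)) (count-heavy p b (S ∘ (q ↑ʳ_))) ⟩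
  2 *ℕ c +ℕ 2 *ℕ count (S ∘ (q ↑ʳ_))
    ≡⟨ ℕ.*-distribˡ-+ 2 c _ ⟨
  2 *ℕ (c +ℕ count (S ∘ (q ↑ʳ_)))
    ≡⟨ cong (2 *ℕ_) (count-++ q S) ⟨
  2 *ℕ count S ∎
  where
  open ℕ.≤-Reasoning
  c : ℕ
  c = count (S ∘ (_↑ˡ p *ℕ q))
  heavy′ : Fin p → Bool
  heavy′ g = does (b ≤? 2 *ℕ count (λ h → S (q ↑ʳ combine g h)))
  first : (d : Dec (b ≤ 2 *ℕ c)) → bit (does d) *ℕ b ≤ 2 *ℕ c
  first (yes p) = subst (_≤ 2 *ℕ c) (sym (ℕ.+-identityʳ b)) p
  first (no _)  = z≤n

module ProductTangle (G H : Graph) {a b : ℕ}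
  (τG : Hypergraph.Tangle (incidence G) a) (τH : Hypergraph.Tangle (incidence H) b) where

  P : Graph
  P = G □ H

  module G = Graph G
  module H = Graph H
  module P = Graph P
  module EG = Hypergraph (incidence G)
  module EH = Hypergraph (incidence H)
  module EP = Hypergraph (incidence P)
  module IG = Incidence G
  module IH = Incidence H
  module IP = Incidence P
  module τG = EG.Tangle τG
  module τH = EH.Tangle τH

  VSet : Set
  VSet = Vertex P → Bool

  Edge : Vertex G × Vertex H → Vertex G × Vertex H → Set
  Edge p q = (proj₁ p ≡ proj₁ q × H.Adj (proj₂ p) (proj₂ q)) ⊎
             (G.Adj (proj₁ p) (proj₁ q) × proj₂ p ≡ proj₂ q)

  vertical : ∀ g {h h′} → H.Adj h h′ → P.Adj (combine g h) (combine g h′)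
  vertical g {h} {h′} a =
    subst₂ Edge (sym (Fin.remQuot-combine g h)) (sym (Fin.remQuot-combine g h′)) (inj₁ (refl , a))

  horizontal : ∀ {g g′} h → G.Adj g g′ → P.Adj (combine g h) (combine g′ h)
  horizontal {g} {g′} h a =
    subst₂ Edge (sym (Fin.remQuot-combine g h)) (sym (Fin.remQuot-combine g′ h)) (inj₂ (a , refl))

  lift : Vertex G → Fin (H.order *ℕ H.order) → Fin (P.order *ℕ P.order)
  lift g e = combine (combine g (IH.source e)) (combine g (IH.target e))

  incidence-lift : ∀ g e {h} → incidence H e h ≡ true → incidence P (lift g e) (combine g h) ≡ true
  incidence-lift g e eh with IH.incidence⁻ e eh
  ... | inj₁ refl       = IP.incidence-left _ _
  ... | inj₂ (refl , a) = IP.incidence-right (vertical g a)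

  slice : EP.ESet → Vertex G → EH.ESet
  slice F g e = F (lift g e)

  fiber : VSet → Vertex G → Vertex H → Bool
  fiber S g h = S (combine g h)

  clopen-slice : ∀ {S F} g → EP.Clopen S F → EH.Clopen (fiber S g) (slice F g)
  clopen-slice g cF {e = e} {e′} p q i j = cF p q (incidence-lift g e i) (incidence-lift g e′ j)

  heavy : VSet → Vertex G → Bool
  heavy S g = does (b ≤? 2 *ℕ count (fiber S g))

  light : ∀ S g → heavy S g ≡ false → 2 *ℕ count (fiber S g) < b
  light S g h = ℕ.≰⇒> λ p → true≢false (dec-true (b ≤? 2 *ℕ count (fiber S g)) p) h

  light-< : ∀ S g → heavy S g ≡ false → count (fiber S g) < b
  light-< S g h = ℕ.≤-<-trans (ℕ.m≤n*m (count (fiber S g)) 2) (light S g h)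

  heavy-mono : ∀ {S S′} → S ⊑ S′ → heavy S ⊑ heavy S′
  heavy-mono {S} {S′} S⊑ g h = dec-true (b ≤? 2 *ℕ count (fiber S′ g))
    (ℕ.≤-trans (does⁻ (b ≤? 2 *ℕ count (fiber S g)) h) (ℕ.*-monoʳ-≤ 2 (count-mono (S⊑ ∘ combine g))))

  Few : VSet → Set
  Few S = 2 *ℕ count S < a *ℕ b

  few-heavy : ∀ {S} → Few S → count (heavy S) < a
  few-heavy {S} few = ℕ.*-cancelʳ-< b _ a (ℕ.≤-<-trans (count-heavy G.order b S) few)

  -- Two light fibers together meet `S` in fewer than `b` vertices. The difference of the two slices
  -- touches only these vertices and is small, so a small slice at `g′` would make the slice at `g`
  -- small.
  large-transfer : ∀ {S F g g′} → EP.Clopen S F → G.Adj g g′ → heavy S g ≡ false → heavy S g′ ≡ false →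
                   τH.small (slice F g) ≡ false → τH.small (slice F g′) ≡ false
  large-transfer {S} {F} {g} {g′} cF g~g′ lg lg′ large = ¬true⇒false λ sm →
    true≢false (τH.small-⊑ cover
      (τH.small-∪ few (EH.clopen-∖ cg cg′) cg′ (τH.small-bag (ℕ.≤-<-trans (count-mono touchD) few)) sm)) large
    where
    D : EH.ESet
    D = slice F g ∖ slice F g′
    S″ : Vertex H → Bool
    S″ = fiber S g ∪ fiber S g′
    few : count S″ < b
    few = ℕ.*-cancelˡ-< 2 (count S″) b (ℕ.≤-<-trans (ℕ.*-monoʳ-≤ 2 (count-∪ (fiber S g) (fiber S g′)))
      (ℕ.≤-<-trans (ℕ.≤-reflexive (ℕ.*-distribˡ-+ 2 (count (fiber S g)) (count (fiber S g′))))
        (ℕ.<-≤-trans (ℕ.+-mono-< (light S g lg) (light S g′ lg′))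
          (ℕ.≤-reflexive (cong (b +ℕ_) (sym (ℕ.+-identityʳ b)))))))
    cg : EH.Clopen S″ (slice F g)
    cg = EH.clopen-mono {fiber S g} (λ h → ∨-true⁺ˡ {fiber S g h} {fiber S g′ h}) (clopen-slice g cF)
    cg′ : EH.Clopen S″ (slice F g′)
    cg′ = EH.clopen-mono {fiber S g′} (λ h → ∨-true⁺ʳ {fiber S g h} {fiber S g′ h}) (clopen-slice g′ cF)
    cover : slice F g ⊑ D ∪ slice F g′
    cover e p with true⊎false (slice F g′ e)
    ... | inj₁ q = ∨-true⁺ʳ {D e} q
    ... | inj₂ q = ∨-true⁺ˡ (∧-true⁺ p (not-true⁺ q))
    -- The edge joining the copies of h in the two fibers lies in F or outside F.
    touchD : EH.touch D ⊑ S″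
    touchD h t with EH.touch⁻ {D} t
    ... | e , De , eh with ∧-true⁻ {slice F g e} De | true⊎false (F (combine (combine g h) (combine g′ h)))
    ...   | p , q | inj₁ r = ∨-true⁺ʳ {fiber S g h}
      (cF r (not-true⁻ q) (IP.incidence-right (horizontal h g~g′)) (incidence-lift g′ e eh))
    ...   | p , q | inj₂ r = ∨-true⁺ˡ (cF p r (incidence-lift g e eh) (IP.incidence-left _ _))

  -- The trace of `F` on `G`: the tangle of `H` judges each light fiber, and the tangle of `G` is
  -- then asked about the edges at the fibers found large.
  shadow : VSet → EP.ESet → EG.ESet
  shadow S F e = any (λ g → incidence G e g ∧ (not (heavy S g) ∧ not (τH.small (slice F g))))

  shadow⁺ : ∀ S F {e} g → incidence G e g ≡ true → heavy S g ≡ false → τH.small (slice F g) ≡ false →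
            shadow S F e ≡ true
  shadow⁺ S F g i l s = any⁺ _ g (∧-true⁺ i (∧-true⁺ (not-true⁺ l) (not-true⁺ s)))

  shadow⁻ : ∀ {S F e} → shadow S F e ≡ true →
            ∃ λ g → incidence G e g ≡ true × heavy S g ≡ false × τH.small (slice F g) ≡ false
  shadow⁻ {S} {F} {e} h with any⁻ (λ g → incidence G e g ∧ (not (heavy S g) ∧ not (τH.small (slice F g)))) h
  ... | g , p with ∧-true⁻ {incidence G e g} p
  ...   | i , q with ∧-true⁻ {not (heavy S g)} q
  ...     | l , s = g , i , not-true⁻ l , not-true⁻ s

  -- If the common end `v` were light, largeness would transfer to it along `e`, and `e′` would
  -- belong to the shadow too.
  clopen-shadow : ∀ {S F} → EP.Clopen S F → EG.Clopen (heavy S) (shadow S F)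
  clopen-shadow {S} {F} cF {v} {e} {e′} p q i j = ¬false⇒true λ l → true≢false (shadow⁺ S F v j l (large l)) q
    where
    large : heavy S v ≡ false → τH.small (slice F v) ≡ false
    large l with shadow⁻ {S} {F} p
    ... | g , ig , lg , sg with IG.incidence-adjacent e ig i
    ...   | inj₁ refl = sg
    ...   | inj₂ g~v  = large-transfer {S} {F} cF g~v lg l sg

  Small : VSet → EP.ESet → Set
  Small S F = τG.small (shadow S F) ≡ true

  Small-⊑ : ∀ {S F F′} → F ⊑ F′ → Small S F′ → Small S F
  Small-⊑ {S} {F} {F′} F⊑ = τG.small-⊑ shadow⊑
    where
    shadow⊑ : shadow S F ⊑ shadow S F′
    shadow⊑ e p with shadow⁻ {S} {F} p
    ... | g , i , l , s = shadow⁺ S F′ g i l (¬true⇒false λ s′ → true≢false (τH.small-⊑ (F⊑ ∘ lift g) s′) s)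

  -- Over a light fiber the slice touches fewer than `b` vertices and is small, so the shadow is
  -- empty.
  Small-bag : ∀ {S F} → Few S → EP.touch F ⊑ S → Small S F
  Small-bag {S} {F} few F⊑S = τG.small-bag (ℕ.≤-<-trans (count-mono none) (few-heavy few))
    where
    none : EG.touch (shadow S F) ⊑ heavy S
    none v t with EG.touch⁻ {shadow S F} t
    ... | e , p , _ with shadow⁻ {S} {F} p
    ...   | g , i , l , s = ⊥-elim (true≢false (τH.small-bag (ℕ.≤-<-trans (count-mono touch⊑) (light-< S g l))) s)
      where
      touch⊑ : EH.touch (slice F g) ⊑ fiber S g
      touch⊑ h t with EH.touch⁻ {slice F g} t
      ... | e , Fe , eh = F⊑S _ (EP.touch⁺ Fe (incidence-lift g e eh))

  Small-∪ : ∀ {S F F′} → Few S → EP.Clopen S F → EP.Clopen S F′ → Small S F → Small S F′ → Small S (F ∪ F′)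
  Small-∪ {S} {F} {F′} few cF cF′ sF sF′ =
    τG.small-⊑ shadow⊑ (τG.small-∪ (few-heavy few) (clopen-shadow cF) (clopen-shadow cF′) sF sF′)
    where
    shadow⊑ : shadow S (F ∪ F′) ⊑ shadow S F ∪ shadow S F′
    shadow⊑ e p with shadow⁻ {S} {F ∪ F′} p
    ... | g , i , l , s with true⊎false (τH.small (slice F g)) | true⊎false (τH.small (slice F′ g))
    ...   | inj₂ r | _      = ∨-true⁺ˡ (shadow⁺ S F g i l r)
    ...   | inj₁ _ | inj₂ r = ∨-true⁺ʳ {shadow S F e} (shadow⁺ S F′ g i l r)
    ...   | inj₁ r | inj₁ r′ = ⊥-elim (true≢false
      (τH.small-∪ (light-< S g l) (clopen-slice g cF) (clopen-slice g cF′) r r′) s)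

  -- A larger separator has fewer light fibers, so the shadow shrinks.
  Small-enlarge : ∀ {S S′ F} → S ⊑ S′ → Small S F → Small S′ F
  Small-enlarge {S} {S′} {F} S⊑ = τG.small-⊑ shadow⊑
    where
    shadow⊑ : shadow S′ F ⊑ shadow S F
    shadow⊑ e p with shadow⁻ {S′} {F} p
    ... | g , i , l , s = shadow⁺ S F g i (¬true⇒false λ h → true≢false (heavy-mono {S} {S′} S⊑ g h) l) s

  -- The edges that no shadow over `S` can contain, since all their ends are heavy.
  within : VSet → EG.ESet
  within S e = not (any (λ g → incidence G e g ∧ not (heavy S g)))

  within⁺ : ∀ S {e} → (∀ g → incidence G e g ≡ true → heavy S g ≡ true) → within S e ≡ true
  within⁺ S {e} f = not-true⁺ (¬true⇒false λ h →
    let g , p = any⁻ (λ g → incidence G e g ∧ not (heavy S g)) h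
        i , l = ∧-true⁻ {incidence G e g} p
    in true≢false (f g i) (not-true⁻ l))

  touch-within : ∀ {S} → EG.touch (within S) ⊑ heavy S
  touch-within {S} v t with EG.touch⁻ {within S} t
  ... | e , p , i = ¬false⇒true λ l → true≢false (any⁺ _ v (∧-true⁺ i (not-true⁺ l))) (not-true⁻ p)

  within-small : ∀ {S} → Few S → τG.small (within S) ≡ true
  within-small {S} few = τG.small-bag (ℕ.≤-<-trans (count-mono (touch-within {S})) (few-heavy few))

  -- Passing to the smaller `S` adds to the shadow only edges whose ends are all heavy for `S′`:
  -- largeness transfers, over `S`, to any end that is light for `S′`. Those edges form a small set.
  Small-shrink : ∀ {S S′ F} → Few S′ → S ⊑ S′ → EP.Clopen S F → Small S′ F → Small S F
  Small-shrink {S} {S′} {F} few S⊑ cF sF = τG.small-⊑ shadow⊑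
    (τG.small-∪ (few-heavy few) (clopen-shadow (EP.clopen-mono S⊑ cF)) (EG.clopen-touch (touch-within {S′}))
      sF (within-small few))
    where
    shadow⊑ : shadow S F ⊑ shadow S′ F ∪ within S′
    shadow⊑ e p with shadow⁻ {S} {F} p | true⊎false (shadow S′ F e)
    ... | _             | inj₁ q = ∨-true⁺ˡ q
    ... | g , i , l , s | inj₂ q = ∨-true⁺ʳ {shadow S′ F e} (within⁺ S′ heavyEnd)
      where
      heavyEnd : ∀ g′ → incidence G e g′ ≡ true → heavy S′ g′ ≡ true
      heavyEnd g′ i′ = ¬false⇒true λ l′ → true≢false (shadow⁺ S′ F g′ i′ l′ (large l′)) q
        where
        large : heavy S′ g′ ≡ false → τH.small (slice F g′) ≡ false
        large l′ with IG.incidence-adjacent e i i′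
        ... | inj₁ refl = s
        ... | inj₂ g~g′ = large-transfer {S} {F} cF g~g′ l
          (¬true⇒false λ h → true≢false (heavy-mono {S} {S′} S⊑ g′ h) l′) s

  -- Every edge of `G` with a light end lies in the shadow of `full`, and the others form a small
  -- set; together they would make all of `G` small.
  ¬Small-full : ∀ {S} → Few S → ¬ Small S full
  ¬Small-full {S} few sF = true≢false (τG.small-⊑ cover
    (τG.small-∪ (few-heavy few) (clopen-shadow {S} {full} (λ _ ())) (EG.clopen-touch (touch-within {S}))
      sF (within-small few)))
    τG.full-large
    where
    cover : full ⊑ shadow S full ∪ within S
    cover e _ with true⊎false (shadow S full e)
    ... | inj₁ q = ∨-true⁺ˡ q
    ... | inj₂ q = ∨-true⁺ʳ {shadow S full e} (within⁺ S λ g i →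
      ¬false⇒true λ l → true≢false (shadow⁺ S full g i l τH.full-large) q)

-- Walks in trees

module Walks (T : Graph) where
  open Graph T using (order; Adj; irrefl)

  Walk : (Vertex T → Set) → Vertex T → Vertex T → Set
  Walk Q = Star (λ a b → Q a × Q b × Adj a b)

  -- For an edge pt of a tree: the nodes on the side of t.
  Beyond : Vertex T → Vertex T → Vertex T → Set
  Beyond p = Walk (λ a → ¬ a ≡ p)

  -- The list omits the first vertex, so that `a ∷ vs` is the whole path from `a` to `z`.
  data SimplePath (z : Vertex T) : Vertex T → List (Vertex T) → Set where
    end  : SimplePath z z []
    cons : ∀ {a b vs} → Adj a b → a ∉ᴸ b ∷ vs → SimplePath z b vs → SimplePath z a (b ∷ vs)

  suffix : ∀ {z a b vs} → a ∈ᴸ b ∷ vs → SimplePath z b vs →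
           ∃ λ ws → SimplePath z a ws × (∀ {v} → v ∈ᴸ a ∷ ws → v ∈ᴸ b ∷ vs)
  suffix (here refl) s              = _ , s , λ m → m
  suffix (there m)   (cons _ _ s) with suffix m s
  ... | ws , s′ , sub = ws , s′ , there ∘ sub

  -- Loop erasure: if `a` recurs on the path built so far, continue from that occurrence.
  walk⇒simplePath : ∀ {p a z} → ¬ a ≡ p → Beyond p a z → ∃ λ vs → SimplePath z a vs × p ∉ᴸ a ∷ vs
  walk⇒simplePath a≢p ε = [] , end , λ { (here eq) → a≢p (sym eq) }
  walk⇒simplePath {p} {a} a≢p ((_ , b≢p , ab) ◅ w) with walk⇒simplePath b≢p w
  ... | vs , s , p∉ with a ∈? (_ ∷ vs)
    where open DecMembership (Fin._≟_ {order}) using (_∈?_)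
  ...   | no  a∉ = _ , cons ab a∉ s , λ { (here eq) → a≢p (sym eq) ; (there m) → p∉ m }
  ...   | yes a∈ with suffix a∈ s
  ...     | ws , s′ , sub = ws , s′ , p∉ ∘ sub

  simplePath-injective : ∀ {z a vs} → SimplePath z a vs → Injective _≡_ _≡_ (List.lookup (a ∷ vs))
  simplePath-injective _             {zero}  {zero}  _  = refl
  simplePath-injective (cons _ a∉ _) {zero}  {suc j} eq = ⊥-elim (a∉ (subst (_∈ᴸ _) (sym eq) (∈-lookup j)))
  simplePath-injective (cons _ a∉ _) {suc i} {zero}  eq = ⊥-elim (a∉ (subst (_∈ᴸ _) eq (∈-lookup i)))
  simplePath-injective (cons _ _ s)  {suc i} {suc j} eq = cong suc (simplePath-injective s eq)

  simplePath-step : ∀ {z a vs} → SimplePath z a vs → ∀ i →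
                    Adj (List.lookup (a ∷ vs) (inject₁ i)) (List.lookup (a ∷ vs) (suc i))
  simplePath-step (cons ab _ _) zero    = ab
  simplePath-step (cons _ _ s)  (suc i) = simplePath-step s i

  simplePath-last : ∀ {z a vs} → SimplePath z a vs → List.lookup (a ∷ vs) (fromℕ (length vs)) ≡ z
  simplePath-last end          = refl
  simplePath-last (cons _ _ s) = simplePath-last s

  closeCycle : ∀ {z p a b vs} → SimplePath z p (a ∷ b ∷ vs) → Adj z p → Cycle T
  closeCycle {p = p} {a} {b} {vs} s zp = record
    { k        = length vs
    ; c        = List.lookup (p ∷ a ∷ b ∷ vs)
    ; distinct = simplePath-injective s
    ; step     = simplePath-step s
    ; close    = subst (λ v → Adj v p) (sym (simplePath-last s)) zp
    }

  -- Otherwise a simple path from `t` to `x` that avoids `p` closes to a cycle through `p`.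
  bridge : ¬ Cycle T → ∀ {p t x} → Adj p t → Beyond p t x → Adj x p → x ≡ t
  bridge acyclic {p} {t} {x} pt w xp with walk⇒simplePath (λ eq → irrefl (sym eq) pt) w
  ... | _ , end , _                  = refl
  ... | _ , s@(cons _ _ _) , p∉ = ⊥-elim (acyclic (closeCycle (cons pt p∉ s) xp))

  beyond-≢ : ∀ {p t x} → ¬ t ≡ p → Beyond p t x → ¬ x ≡ p
  beyond-≢ t≢p ε                     = t≢p
  beyond-≢ t≢p ((_ , b≢p , _) ◅ w) = beyond-≢ b≢p w

  beyond-snoc : ∀ {p t x y} → ¬ t ≡ p → Beyond p t x → Adj x y → ¬ y ≡ p → Beyond p t y
  beyond-snoc t≢p w xy y≢p = w ◅◅ ((beyond-≢ t≢p w , y≢p , xy) ◅ ε)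

  beyond-⊆ : ¬ Cycle T → ∀ {p t q s} → Adj p t → Adj t q → ¬ q ≡ p → Beyond t q s → Beyond p t s
  beyond-⊆ acyclic {p} {t} {q} pt tq q≢p = go ε ((t≢p , q≢p , tq) ◅ ε)
    where
    t≢p : ¬ t ≡ p
    t≢p eq = irrefl (sym eq) pt
    go : ∀ {x s} → Beyond t q x → Beyond p t x → Beyond t x s → Beyond p t s
    go r₁ r₂ ε = r₂
    go r₁ r₂ ((_ , y≢t , xy) ◅ w) = go r₁′ (beyond-snoc t≢p r₂ xy y≢p) w
      where
      r₁′ = beyond-snoc (λ eq → irrefl (sym eq) tq) r₁ xy y≢t
      y≢p : ¬ _ ≡ p
      -- `p` is a neighbour of `t`; meeting it beyond the edge `tq` would force it to be `q`.
      y≢p refl = q≢p (sym (bridge acyclic tq r₁′ pt))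

  lastVisit : ∀ {Q} t {a s} → Walk Q a s →
              (¬ a ≡ t × Beyond t a s) ⊎ s ≡ t ⊎ ∃ λ q → Adj t q × Q q × Beyond t q s
  lastVisit t {a} ε with a Fin.≟ t
  ... | yes eq = inj₂ (inj₁ eq)
  ... | no a≢t = inj₁ (a≢t , ε)
  lastVisit t {a} ((_ , Qb , ab) ◅ w) with lastVisit t w
  ... | inj₂ r = inj₂ r
  ... | inj₁ (b≢t , r) with a Fin.≟ t
  ...   | yes refl = inj₂ (inj₂ (_ , ab , Qb , r))
  ...   | no a≢t   = inj₁ (a≢t , (a≢t , b≢t , ab) ◅ r)

  leaveNode : ∀ {Q t s} → Walk Q t s → s ≡ t ⊎ ∃ λ q → Adj t q × Q q × Beyond t q s
  leaveNode {t = t} w with lastVisit t w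
  ... | inj₁ (t≢t , _) = ⊥-elim (t≢t refl)
  ... | inj₂ r         = r

-- Sweeping a tree-decomposition of the product

-- Double-negation shift over a finite index set.
¬¬-sequence : ∀ {n} {P : Fin n → Set} → (∀ i → ¬ ¬ P i) → ¬ ¬ (∀ i → P i)
¬¬-sequence {zero}  h k = k λ ()
¬¬-sequence {suc n} h k = h zero λ p → ¬¬-sequence (h ∘ suc) λ ps → k λ { zero → p ; (suc i) → ps i }

nonZero⇒Fin : ∀ n → NonZero n → Fin n
nonZero⇒Fin (suc n) _ = zero

module Sweep (G H : Graph) {a b : ℕ}
  (τG : Hypergraph.Tangle (incidence G) a) (τH : Hypergraph.Tangle (incidence H) b)
  (D : TreeDecomposition (G □ H)) where
  open ProductTangle G H τG τH
  open TreeDecomposition D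
  open Walks T
  module T = Graph T

  ESet : Set
  ESet = EP.ESet

  bag : Vertex T → VSet
  bag t = lookup (β t)

  acyclic : ¬ Cycle T
  acyclic = IsTree.acyclic isTree

  opaque
    -- An adjacent pair gets a node from edge coverage; any other pair is a loop and gets one from
    -- vertex coverage.
    home : ∀ e → ∃ λ t → ∀ v → incidence P e v ≡ true → bag t v ≡ true
    home e with P.adj? (IP.source e) (IP.target e)
    ... | yes st with edgeCovered st
    ...   | t , s∈ , t∈ = t , λ v ev →
      [ (λ { refl → Vec.[]=⇒lookup s∈ })
      , (λ { (refl , _) → Vec.[]=⇒lookup t∈ }) ]′ (IP.incidence⁻ e ev)
    home e | no ¬st with vertexCovered (IP.source e)
    ...   | t , s∈ = t , λ v ev →
      [ (λ { refl → Vec.[]=⇒lookup s∈ })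
      , (λ { (_ , st) → ⊥-elim (¬st st) }) ]′ (IP.incidence⁻ e ev)

  ν : Fin (P.order *ℕ P.order) → Vertex T
  ν e = proj₁ (home e)

  at : (Vertex T → Bool) → ESet
  at X e = X (ν e)

  union : ∀ {n} → (Fin n → ESet) → ESet
  union F e = any (λ i → F i e)

  clopen-union : ∀ {n S} (F : Fin n → ESet) → (∀ i → EP.Clopen S (F i)) → EP.Clopen S (union F)
  clopen-union {zero}  F c = λ ()
  clopen-union {suc n} F c =
    EP.clopen-∪ {X = F zero} {union (F ∘ suc)} (c zero) (clopen-union (F ∘ suc) (c ∘ suc))

  Small-∅ : ∀ {S} → Few S → Small S ∅
  Small-∅ few = Small-bag few (λ v h → ⊥-elim (EP.¬touch-∅ v h))

  Small-union : ∀ {n S} (F : Fin n → ESet) → Few S →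
                (∀ i → EP.Clopen S (F i)) → (∀ i → Small S (F i)) → Small S (union F)
  Small-union {zero}  F few c s = Small-∅ few
  Small-union {suc n} {S} F few c s =
    Small-∪ {S} {F zero} {union (F ∘ suc)} few (c zero) (clopen-union (F ∘ suc) (c ∘ suc)) (s zero)
      (Small-union (F ∘ suc) few (c ∘ suc) (s ∘ suc))

  -- Turns a union over selected neighbours into a union over all nodes.
  guard : ∀ {A : Set} → Dec A → ESet → ESet
  guard (yes _) F = F
  guard (no _)  F = ∅

  guard⁺ : ∀ {A : Set} (A? : Dec A) → A → ∀ {F} → F ⊑ guard A? F
  guard⁺ (yes _) _ _ p = p
  guard⁺ (no ¬a) a _ _ = ⊥-elim (¬a a)

  clopen-guard : ∀ {A S F} (A? : Dec A) → (A → EP.Clopen S F) → EP.Clopen S (guard A? F)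
  clopen-guard (yes a) c = c a
  clopen-guard (no _)  c = λ ()

  Small-guard : ∀ {A S F} → Few S → (A? : Dec A) → (A → Small S F) → Small S (guard A? F)
  Small-guard few (yes a) s = s a
  Small-guard few (no _)  s = Small-∅ few

  module _ (beyond? : ∀ p t s → Dec (Beyond p t s)) (few : ∀ t → Few (bag t)) where

    side : Vertex T → Vertex T → Vertex T → Bool
    side p t s = does (beyond? p t s)

    -- The nodes whose bags contain `v` join the homes of `e` and `e′` by a walk. It leaves the side
    -- of `t`, hence crosses the edge `tp`, and both bags there contain `v`.
    clopen-side : ∀ {p t} → T.Adj p t → EP.Clopen (bag p ∩ bag t) (at (side p t))
    clopen-side {p} {t} pt {v} {e} {e′} Fe Fe′ ev e′v =
      exit (vertexConnected v (Vec.lookup⇒[]= v _ (proj₂ (home e) v ev))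
                              (Vec.lookup⇒[]= v _ (proj₂ (home e′) v e′v)))
           (does⁻ (beyond? p t (ν e)) Fe)
      where
      t≢p : ¬ t ≡ p
      t≢p eq = T.irrefl (sym eq) pt
      exit : ∀ {x} → Walk (BagsContaining v) x (ν e′) → Beyond p t x → (bag p ∩ bag t) v ≡ true
      exit ε r = ⊥-elim (true≢false (dec-true (beyond? p t (ν e′)) r) Fe′)
      exit (_◅_ {j = y} (v∈x , v∈y , xy) w) r with y Fin.≟ p
      ... | no y≢p = exit w (beyond-snoc t≢p r xy y≢p)
      ... | yes refl with bridge acyclic pt r xy
      ...   | refl = ∧-true⁺ (Vec.[]=⇒lookup v∈y) (Vec.[]=⇒lookup v∈x)

    -- An edge is at home at `t` or in a branch through which a walk leaves `t` for the last time.
    -- All these pieces are clopen over `bag t`, so their union is small. `Q` serves to exclude the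
    -- parent of `t`.
    Small-node : ∀ {Q : Vertex T → Set} → (∀ q → Dec (Q q)) → ∀ t →
                 (∀ q → T.Adj t q → Q q → Small (bag t) (at (side t q))) →
                 ∀ X → (∀ s → X s ≡ true → Walk Q t s) → Small (bag t) (at X)
    Small-node {Q} Q? t hyp X walk = Small-⊑ {bag t} {at X} cover
      (Small-∪ {bag t} {here-edges} {union branch} (few t) (EP.clopen-touch touch-here)
        (clopen-union branch clopen-branch)
        (Small-bag (few t) touch-here) (Small-union branch (few t) clopen-branch small-branch))
      where
      here-edges : ESet
      here-edges = at (λ s → does (s Fin.≟ t))
      branch : Vertex T → ESet
      branch q = guard (T.adj? t q ×-dec Q? q) (at (side t q))
      clopen-branch : ∀ q → EP.Clopen (bag t) (branch q)
      clopen-branch q = clopen-guard (T.adj? t q ×-dec Q? q) λ (tq , _) →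
        EP.clopen-mono {bag t ∩ bag q} (λ v → proj₁ ∘ ∧-true⁻ {bag t v}) (clopen-side tq)
      small-branch : ∀ q → Small (bag t) (branch q)
      small-branch q = Small-guard (few t) (T.adj? t q ×-dec Q? q) λ (tq , Qq) → hyp q tq Qq
      touch-here : EP.touch here-edges ⊑ bag t
      touch-here v h with EP.touch⁻ {here-edges} h
      ... | e , p , ev = subst (λ s → bag s v ≡ true) (does⁻ (ν e Fin.≟ t) p) (proj₂ (home e) v ev)
      cover : at X ⊑ here-edges ∪ union branch
      cover e p with leaveNode (walk (ν e) p)
      ... | inj₁ eq = ∨-true⁺ˡ (dec-true (ν e Fin.≟ t) eq)
      ... | inj₂ (q , tq , Qq , r) = ∨-true⁺ʳ {here-edges e} (any⁺ (λ q → branch q e) q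
        (guard⁺ (T.adj? t q ×-dec Q? q) (tq , Qq) e (dec-true (beyond? t q (ν e)) r)))

    -- Induction on the number of nodes beyond the edge. Smallness passes from `bag t` to `bag p`
    -- through their intersection, over which the side is clopen.
    Small-side : ∀ p t → T.Adj p t → Small (bag p) (at (side p t))
    Small-side p t pt = <-rec M step _ p t pt refl
      where
      M : ℕ → Set
      M c = ∀ p t → T.Adj p t → count (side p t) ≡ c → Small (bag p) (at (side p t))
      step : ∀ c → (∀ {c′} → c′ < c → M c′) → M c
      step _ rec p t pt refl =
        Small-enlarge {bag p ∩ bag t} {bag p} {at (side p t)} (λ v → proj₁ ∘ ∧-true⁻ {bag p v})
          (Small-shrink {bag p ∩ bag t} {bag t} {at (side p t)} (few t)
            (λ v → proj₂ ∘ ∧-true⁻ {bag p v}) (clopen-side pt)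
            (Small-node (λ q → ¬? (q Fin.≟ p)) t (λ q tq q≢p → rec (smaller tq q≢p) t q tq refl)
              (side p t) (λ s → does⁻ (beyond? p t s))))
        where
        smaller : ∀ {q} → T.Adj t q → ¬ q ≡ p → count (side t q) < count (side p t)
        smaller {q} tq q≢p = count-mono-<
          (λ s h → dec-true (beyond? p t s) (beyond-⊆ acyclic pt tq q≢p (does⁻ (beyond? t q s) h))) t
          (¬true⇒false λ h → beyond-≢ (λ eq → T.irrefl (sym eq) tq) (does⁻ (beyond? t q t) h) refl)
          (dec-true (beyond? p t t) ε)

    impossible : ⊥
    impossible = ¬Small-full (few root)
      (Small-node {U} (λ _ → yes _) root (λ q tq _ → Small-side root q tq) full
        (λ s _ → IsTree.connected isTree _ _))
      where
      root : Vertex T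
      root = nonZero⇒Fin T.order (IsTree.nonEmpty isTree)

  ¬few : ¬ (∀ t → Few (bag t))
  -- The goal is empty, so `Beyond` may be assumed decidable for the finitely many triples of nodes.
  ¬few few = ¬¬-sequence (λ p → ¬¬-sequence λ t → ¬¬-sequence λ s → ¬¬-excluded-middle {A = Beyond p t s})
    λ beyond? → impossible beyond? few

-- From maximal bag sizes to widths

count-lookup : ∀ {n} (S : Subset n) → count (lookup S) ≡ ∣ S ∣
count-lookup []          = refl
count-lookup (true ∷ S)  = cong suc (count-lookup S)
count-lookup (false ∷ S) = count-lookup S

bagSize≤maxBagSize : ∀ {G} (D : TreeDecomposition G) t → ∣ TreeDecomposition.β D t ∣ ≤ maxBagSize D
bagSize≤maxBagSize D t =
  All.lookup (All.map⁻ (xs≤max 0 (List.map (∣_∣ ∘ TreeDecomposition.β D) (allFin _)))) (∈-allFin t)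

order-bound : ∀ {G H} a b → (∀ D → a ≤ maxBagSize {G} D) → (∀ D → b ≤ maxBagSize {H} D) →
              (D : TreeDecomposition (G □ H)) → a *ℕ b ≤ 2 *ℕ maxBagSize D
order-bound zero    b       _  _  D = z≤n
order-bound (suc k) zero    _  _  D = subst (_≤ 2 *ℕ maxBagSize D) (sym (ℕ.*-zeroʳ k)) z≤n
-- Arguing by contradiction allows the use of tangles that exist only up to double negation.
order-bound {G} {H} (suc k) (suc l) minG minH D = ℕ.≮⇒≥ λ lt →
  Assemble.¬¬tangle G k minG λ τG → Assemble.¬¬tangle H l minH λ τH →
  Sweep.¬few G H τG τH D λ t → ℕ.≤-<-trans
    (ℕ.*-monoʳ-≤ 2 (ℕ.≤-trans (ℕ.≤-reflexive (count-lookup (TreeDecomposition.β D t)))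
                              (bagSize≤maxBagSize D t))) lt

-- The same rational as i / 1, but in a form on which toℚᵘ computes.
fromℤ : ℤ → ℚ
fromℤ i = mkℚ i 0 (coprime-sym (1-coprimeTo _))

/1≡fromℤ : ∀ i → i / 1 ≡ fromℤ i
/1≡fromℤ i = ℚ.↥p/↧p≡p (fromℤ i)

fromℤ-pred : ∀ n → fromℤ (+ n ℤ.- 1ℤ) ≡ fromℤ (+ n) - 1ℚ
fromℤ-pred n = ℚ.toℚᵘ-injective (ℚᵘ.≃-trans
  (ℚᵘ.*≡* (cong (ℤ._* 1ℤ) (cong (ℤ._+ -1ℤ) (sym (ℤ.*-identityʳ (+ n))))))
  (ℚᵘ.≃-sym (ℚ.toℚᵘ-homo-+ (fromℤ (+ n)) (ℚ.- 1ℚ))))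

/1-pred : ∀ n → (+ n ℤ.- 1ℤ) / 1 ≡ fromℤ (+ n) - 1ℚ
/1-pred n = trans (/1≡fromℤ (+ n ℤ.- 1ℤ)) (fromℤ-pred n)

/1-pred-suc : ∀ n → (+ n ℤ.- 1ℤ) / 1 + 1ℚ ≡ fromℤ (+ n)
/1-pred-suc n = trans (cong (_+ 1ℚ) (/1-pred n))
  (trans (ℚ.+-assoc (fromℤ (+ n)) (ℚ.- 1ℚ) 1ℚ) (ℚ.+-identityʳ (fromℤ (+ n))))

half-product≤ : ∀ a b c → a *ℕ b ≤ 2 *ℕ c → ½ * fromℤ (+ a) * fromℤ (+ b) ℚ.≤ fromℤ (+ c)
half-product≤ a b c h = ℚ.toℚᵘ-cancel-≤ (begin
  toℚᵘ (½ * fromℤ (+ a) * fromℤ (+ b)) ≃⟨ ℚ.toℚᵘ-homo-* (½ * fromℤ (+ a)) (fromℤ (+ b)) ⟩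
  toℚᵘ (½ * fromℤ (+ a)) ℚᵘ.* toℚᵘ (fromℤ (+ b)) ≃⟨ ℚᵘ.*-congʳ (ℚ.toℚᵘ-homo-* ½ (fromℤ (+ a))) ⟩
  toℚᵘ ½ ℚᵘ.* toℚᵘ (fromℤ (+ a)) ℚᵘ.* toℚᵘ (fromℤ (+ b)) ≤⟨ ℚᵘ.*≤* numerators ⟩
  toℚᵘ (fromℤ (+ c)) ∎)
  where
  open ℚᵘ.≤-Reasoning
  -- Cross-multiplication with the denominators 2 on the left and 1 on the right.
  numerators : 1ℤ ℤ.* + a ℤ.* + b ℤ.* 1ℤ ℤ.≤ + c ℤ.* + 2
  numerators = subst₂ ℤ._≤_
    (trans (ℤ.pos-* a b) (sym (trans (ℤ.*-identityʳ _) (cong (ℤ._* + b) (ℤ.*-identityˡ (+ a))))))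
    (trans (cong +_ (ℕ.*-comm 2 c)) (ℤ.pos-* c 2)) (ℤ.+≤+ h)

width-bound : ∀ a b c → a *ℕ b ≤ 2 *ℕ c →
              (+ c ℤ.- 1ℤ) / 1 ≥ ½ * ((+ a ℤ.- 1ℤ) / 1 + 1ℚ) * ((+ b ℤ.- 1ℤ) / 1 + 1ℚ) - 1ℚ
width-bound a b c h = subst₂ ℚ._≤_
  (sym (cong₂ (λ x y → ½ * x * y - 1ℚ) (/1-pred-suc a) (/1-pred-suc b)))
  (sym (/1-pred c))
  (ℚ.+-monoˡ-≤ (ℚ.- 1ℚ) (half-product≤ a b c h))

theorem3 : (G H : Graph) (twG twH twGH : ℤ) →
    Treewidth G twG → Treewidth H twH → Treewidth (G □ H) twGH →
    twGH / 1 ≥ ½ * (twG / 1 + 1ℚ) * (twH / 1 + 1ℚ) - 1ℚ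
theorem3 G H _ _ _ ((DG , refl) , minG) ((DH , refl) , minH) ((D , refl) , _)
  = width-bound (maxBagSize DG) (maxBagSize DH) (maxBagSize D)
    (order-bound (maxBagSize DG) (maxBagSize DH) (sizes DG minG) (sizes DH minH) D)
  where
  sizes : ∀ {G} (D₀ : TreeDecomposition G) → (∀ D → width D₀ ℤ.≤ width D) → ∀ D → maxBagSize D₀ ≤ maxBagSize D
  sizes _ min D = ℤ.drop‿+≤+ (subst₂ ℤ._≤_ (pred-suc _) (pred-suc _) (ℤ.+-monoˡ-≤ 1ℤ (min D)))
    where
    pred-suc : ∀ i → i ℤ.- 1ℤ ℤ.+ 1ℤ ≡ i
    pred-suc i = trans (ℤ.+-assoc i -1ℤ 1ℤ) (ℤ.+-identityʳ i)
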